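{- Let $k\ge3$, let $s\ge0$ be an integer, and let $\mathbf F$ be a satisfiable $(\le k)$-CNF formula that is $s$-implication free. For $l$ chosen uniformly at random from $\mathrm{SL}(\mathbf F)$, \[\mathbb E_l\big[c(\mathbf F^{[l]})\big]\le c(\mathbf F)-n_N(\mathbf F)\frac{2S}{|\mathrm{SL}(\mathbf F)|}-n_C(\mathbf F)\frac{1}{|\mathrm{SL}(\mathbf F)|}.\]
   Context: A literal is a variable $x$ or its negation $\bar x$; a clause is a finite set of literals over pairwise distinct variables; a CNF formula $\mathbf F=(F,V)$ has variable set $V(\mathbf F)=V$ (finite), $n(\mathbf F)=|V|$, and a finite set $F$ of clauses over $V$; it is $(\le k)$-CNF if all clauses have at most $k$ literals. Assignments on $V$ are maps $V\to\{0,1\}$, identified with the set of literals they satisfy; $\mathrm{sat}(\mathbf F)$ is the set of satisfying assignments on $V(\mathbf F)$. For a literal $l$ over $y\in V(\mathbf F)$, $\mathbf F^{[l]}$ deletes clauses containing $l$, deletes $\bar l$ from clauses, and removes $y$ from the variable set. A literal $l$ over $V(\mathbf F)$ is $s$-implied by $\mathbf F$ if there is $G\subseteq F$ with $|G|\le s$ such that every assignment on $V$ satisfying all clauses of $G$ satisfies $l$; $\mathbf F$ is $s$-implication free if no literal is $s$-implied. $\mathrm{PPSZ}(\mathbf F,\beta,\pi,s)$, for an assignment $\beta$ and a permutation $\pi$ of $V(\mathbf F)$: for each variable $x$ in the order $\pi$: (i) while the current formula has an $s$-implied literal, restrict the current formula to it; (ii) then, if $x$ is still a variable of the current formula, restrict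 it by $x\mapsto\beta(x)$; $x$ is then called guessed. For $\alpha\in\mathrm{sat}(\mathbf F)$, $p_{\mathrm{guessed}}(\mathbf F,x,\alpha,s)$ is the probability over uniform $\pi$ that $x$ is guessed in $\mathrm{PPSZ}(\mathbf F,\alpha,\pi,s)$ ($\alpha$ restricted to $V(\mathbf F)$ if defined on a superset; $0$ if $x\notin V(\mathbf F)$). A variable $x\in V(\mathbf F)$ is frozen if all satisfying assignments of $\mathbf F$ agree on $x$, non-frozen otherwise; $n_N(\mathbf F)$ and $n_C(\mathbf F)$ are the numbers of non-frozen and frozen variables. $\mathrm{SL}(\mathbf F)$ is the set of literals $l$ over $V(\mathbf F)$ with $\mathbf F^{[l]}$ satisfiable. AssignSatisfiableLiterals$(\mathbf F)$: start with the empty assignment; while $V(\mathbf F)\neq\emptyset$, choose $l$ uniformly from $\mathrm{SL}(\mathbf F)$, add it, and set $\mathbf F\leftarrow\mathbf F^{[l]}$; output the assignment. $p(\mathbf F,\alpha)$ is the probability that it outputs $\alpha$ (restricted to $V(\mathbf F)$ if $\alpha$ is on a superset). Cost: let $S_k:=\int_0^1\frac{t^{1/(k-1)}-t}{1-t}\,dt$ and let $S$ be a real number with $S\ge S_k$ such that $p_{\mathrm{guessed}}(\mathbf F',x,\alpha,s)\le S$ for every satisfiable $(\le k)$-CNF $\mathbf F'$, every frozen $x$ of $\mathbf F'$ and every $\alpha\in\mathrm{sat}(\mathbf F')$. Define $c(\mathbf F,x)=0$ if $x\notin V(\mathbf F)$; $c(\mathbf F,x)=S$ if $x$ is non-frozen;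 $c(\mathbf F,x)=\sum_{\alpha\in\mathrm{sat}(\mathbf F)}p(\mathbf F,\alpha)\,p_{\mathrm{guessed}}(\mathbf F,x,\alpha,s)$ if $x$ is frozen; $c(\mathbf F):=\sum_{x\in V(\mathbf F)}c(\mathbf F,x)$.
   Formalization: The number S, which the statement allows to be any real with S ≥ S_k bounding all p_guessed for frozen variables, is taken to be rational, and S ≥ S_k is expressed as S bounding every partial sum of the series expansion of the integral S_k. -}

module Defs where

open import Data.Nat as ℕ using (ℕ; zero; suc; _<ᵇ_; _≡ᵇ_)
open import Data.Bool as B using (Bool; true; false; not; _∧_; _∨_; if_then_else_)
open import Data.Maybe using (Maybe; just; nothing)
open import Data.List using (List; []; _∷_; map; filterᵇ; length; concatMap; foldr; _++_; upTo)
open import Data.Bool.ListAction using (any; all)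
open import Data.Product using (_×_; _,_)
open import Data.Integer using (+_)
open import Data.Rational using (ℚ; 0ℚ; 1ℚ; _+_; _*_; _-_; _/_; _≤_)
open import Data.List.Relation.Unary.Unique.Propositional using (Unique)
open import Data.List.Relation.Unary.All using (All)
open import Data.List.Membership.Propositional using (_∈_)
open import Relation.Binary.PropositionalEquality using (_≡_)
open import Relation.Nullary.Decidable using (⌊_⌋)

record Literal : Set where
  constructor lit
  field
    var : ℕ
    pos : Bool
open Literal public

litEq : Literal → Literal → Bool
litEq l m = (var l ≡ᵇ var m) ∧ ⌊ pos l B.≟ pos m ⌋

neg : Literal → Literal
neg l = lit (var l) (not (pos l))

Clause : Set
Clause = List Literal

record CNF : Set where
  constructor cnf
  field
    vars    : List ℕ
    clauses : List Clause
open CNF public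

memLit : Literal → List Literal → Bool
memLit l = any (litEq l)

memNat : ℕ → List ℕ → Bool
memNat x = any (x ≡ᵇ_)

WF : CNF → Set
WF F = Unique (vars F)
     × All (λ C → All (λ l → var l ∈ vars F) C × Unique (map var C)) (clauses F)

LeK : ℕ → CNF → Set
LeK k F = All (λ C → length C ℕ.≤ k) (clauses F)

restrict : CNF → Literal → CNF
restrict F l =
  cnf (filterᵇ (λ y → not (var l ≡ᵇ y)) (vars F))
      (map (filterᵇ (λ m → not (litEq (neg l) m)))
           (filterᵇ (λ C → not (memLit l C)) (clauses F)))

-- Assignments: an assignment is identified with the list (set) of literals it satisfies.

Assignment : Set
Assignment = List Literal

allAssign : List ℕ → List Assignment
allAssign [] = [] ∷ []
allAssign (x ∷ V) = concatMap (λ α → (lit x true ∷ α) ∷ (lit x false ∷ α) ∷ []) (allAssign V)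

satLit : Assignment → Literal → Bool
satLit α l = memLit l α

satClause : Assignment → Clause → Bool
satClause α C = any (satLit α) C

satAll : Assignment → List Clause → Bool
satAll α G = all (satClause α) G

sat : CNF → List Assignment
sat F = filterᵇ (λ α → satAll α (clauses F)) (allAssign (vars F))

Satisfiable : CNF → Set
Satisfiable F = 0 ℕ.< length (sat F)

literalsOver : List ℕ → List Literal
literalsOver V = concatMap (λ x → lit x true ∷ lit x false ∷ []) V

subs : {A : Set} → ℕ → List A → List (List A)
subs s [] = [] ∷ []
subs zero (c ∷ cs) = [] ∷ []
subs (suc s) (c ∷ cs) = subs (suc s) cs ++ map (c ∷_) (subs s cs)

impliedB : ℕ → CNF → Literal → Bool
impliedB s F l =
  any (λ G → all (λ α → not (satAll α G) ∨ satLit α l) (allAssign (vars F)))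
      (subs s (clauses F))

SImplicationFree : ℕ → CNF → Set
SImplicationFree s F = All (λ l → impliedB s F l ≡ false) (literalsOver (vars F))

firstB : {A : Set} → (A → Bool) → List A → Maybe A
firstB p [] = nothing
firstB p (a ∷ as) = if p a then just a else firstB p as

propagate : ℕ → ℕ → CNF → CNF
propagate zero s F = F
propagate (suc n) s F with firstB (impliedB s F) (literalsOver (vars F))
... | nothing = F
... | just l  = propagate n s (restrict F l)

valueOf : Assignment → ℕ → Bool
valueOf β y = memLit (lit y true) β

guessedRun : ℕ → Assignment → List ℕ → CNF → ℕ → Bool
guessedRun s β [] F x = false
guessedRun s β (y ∷ π) F x =
  let F' = propagate (suc (length (vars F))) s F in
  if memNat y (vars F')
  then (if y ≡ᵇ x then true else guessedRun s β π (restrict F' (lit y (valueOf β y))) x)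
  else guessedRun s β π F' x

inserts : {A : Set} → A → List A → List (List A)
inserts x [] = (x ∷ []) ∷ []
inserts x (y ∷ ys) = (x ∷ y ∷ ys) ∷ map (y ∷_) (inserts x ys)

perms : {A : Set} → List A → List (List A)
perms [] = [] ∷ []
perms (x ∷ xs) = concatMap (inserts x) (perms xs)

frac : ℕ → ℕ → ℚ
frac a zero = 0ℚ
frac a (suc b) = (+ a) / suc b

count : {A : Set} → (A → Bool) → List A → ℕ
count p xs = length (filterᵇ p xs)

sumQ : List ℚ → ℚ
sumQ = foldr _+_ 0ℚ

pGuessed : ℕ → CNF → ℕ → Assignment → ℚ
pGuessed s F x α =
  if memNat x (vars F)
  then frac (count (λ π → guessedRun s α π F x) (perms (vars F))) (length (perms (vars F)))
  else 0ℚ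

SL : CNF → List Literal
SL F = filterᵇ (λ l → 0 <ᵇ length (sat (restrict F l))) (literalsOver (vars F))

pAlg : ℕ → CNF → Assignment → ℚ
pAlg fuel (cnf [] G) α = 1ℚ
pAlg zero (cnf (_ ∷ _) G) α = 0ℚ
pAlg (suc n) F@(cnf (_ ∷ _) G) α =
  sumQ (map (λ l → if memLit l α then frac 1 (length (SL F)) * pAlg n (restrict F l) α else 0ℚ)
            (SL F))

pASL : CNF → Assignment → ℚ
pASL F α = pAlg (length (vars F)) F α

frozenB : CNF → ℕ → Bool
frozenB F x = not (any (λ α → satLit α (lit x true)) (sat F) ∧ any (λ α → satLit α (lit x false)) (sat F))

nN : CNF → ℕ
nN F = count (λ x → not (frozenB F x)) (vars F)

nC : CNF → ℕ
nC F = count (λ x → frozenB F x) (vars F)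

cost : ℚ → ℕ → CNF → ℕ → ℚ
cost S s F x =
  if memNat x (vars F)
  then (if frozenB F x then sumQ (map (λ α → pASL F α * pGuessed s F x α) (sat F)) else S)
  else 0ℚ

costF : ℚ → ℕ → CNF → ℚ
costF S s F = sumQ (map (cost S s F) (vars F))

-- S_k = ∫₀¹ (t^{1/(k-1)} - t)/(1-t) dt = Σ_{j ≥ 0} ( (k-1)/((j+1)(k-1)+1) - 1/(j+2) ),
-- a series of positive terms (k ≥ 3); S ≥ S_k iff S bounds all partial sums.
SkPartial : ℕ → ℕ → ℚ
SkPartial k N = sumQ (map (λ j → frac (k ℕ.∸ 1) (suc j ℕ.* (k ℕ.∸ 1) ℕ.+ 1) - frac 1 (suc (suc j))) (upTo N))

AdmissibleS : ℕ → ℕ → ℚ → Set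
AdmissibleS k s S =
  (∀ N → SkPartial k N ≤ S)
  × (∀ F' → WF F' → LeK k F' → Satisfiable F' →
       ∀ x → x ∈ vars F' → frozenB F' x ≡ true →
       ∀ α → α ∈ sat F' → pGuessed s F' x α ≤ S)

{-# OPTIONS --safe #-}

-- Fix a variable x and put N = |SL(F)|. If x is non-frozen, two of the N literals remove x from the
-- formula and all others leave its cost at most S. If x is frozen, fix α ∈ sat(F), and for a variable
-- y let p_y and g_y be p and p_guessed of F^[α(y)], with p and g those of F itself. Then N p = Σ_y p_y,
-- and n g = 1 + Σ_y g_y since nothing is propagated before the first variable of π. Moreover p ≤ p_y and
-- g_y ≤ g, so summing (p_y − p)(g − g_y) ≥ 0 over y gives Σ_y p_y g_y + p ≤ N p g. Summing over α
-- turns the term p into 1.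

module Submission where

open import Defs
open import Data.Nat using (ℕ; zero; suc; _≤_; _<_; z≤n; s≤s; _≡ᵇ_)
import Data.Nat as ℕ
import Data.Nat.Properties as ℕ
import Data.Integer as ℤ
import Data.Integer.Properties as ℤ
open import Data.Bool using (Bool; true; false; not; _∧_; _∨_; if_then_else_; T; T?)
import Data.Bool as B
import Data.Bool.Properties as B
open import Data.Bool.ListAction using (any; all)
open import Data.Maybe using (just; nothing)
open import Data.List using (List; []; _∷_; map; length; concatMap; filterᵇ; _++_)
import Data.List.Properties as List
open import Data.List.Relation.Unary.Any using (here; there)
open import Data.List.Relation.Unary.All using (All; []; _∷_)
import Data.List.Relation.Unary.All as All
import Data.List.Relation.Unary.All.Properties as All
open import Data.List.Relation.Unary.AllPairs using ([]; _∷_)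
import Data.List.Relation.Unary.AllPairs.Properties as AllPairs
open import Data.List.Relation.Unary.Unique.Propositional using (Unique)
import Data.List.Relation.Unary.Unique.Propositional.Properties as Unique
open import Data.List.Membership.Propositional using (_∈_; _∉_; lose; find)
open import Data.List.Membership.DecPropositional ℕ._≟_ using (_∈?_)
open import Data.List.Membership.Propositional.Properties
  using (∈-filter⁺; ∈-filter⁻; ∈-map⁺; ∈-map⁻; ∈-++⁺ˡ; ∈-++⁺ʳ; ∈-++⁻; ∈-concatMap⁺; ∈-concatMap⁻; ∈-length)
open import Data.List.Relation.Binary.Permutation.Propositional using (_↭_; prep; swap) renaming (refl to ↭-rfl; trans to ↭-trn)
open import Data.List.Relation.Binary.Permutation.Propositional.Properties using (↭-length)
open import Data.List.Relation.Binary.Sublist.Propositional using (_⊆_; []; _∷_; _∷ʳ_; lookup; minimum)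
import Data.List.Relation.Binary.Sublist.Propositional.Properties as Sub
open import Data.Product using (_×_; _,_; proj₁; proj₂; ∃)
open import Data.Sum using (inj₁; inj₂)
open import Data.Empty using (⊥-elim)
open import Data.Rational using (ℚ; 0ℚ; 1ℚ; _+_; _*_; _-_; nonNegative) renaming (_≤_ to _≤ℚ_)
import Data.Rational as ℚ
import Data.Rational.Properties as ℚ
open import Data.Rational.Unnormalised using (mkℚᵘ; *≡*)
import Data.Rational.Unnormalised as ℚᵘ
import Data.Rational.Unnormalised.Properties as ℚᵘ
open import Data.Rational.Solver using (module +-*-Solver)
open import Function using (_∘_; case_of_)
open import Function.Bundles using (Equivalence)
open import Relation.Nullary using (¬_; yes; no; contradiction)
open import Relation.Nullary.Decidable using (⌊_⌋; dec-true; dec-false)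
open import Relation.Binary.PropositionalEquality
  using (_≡_; _≢_; refl; sym; trans; cong; cong₂; subst; subst₂; module ≡-Reasoning)

when : Bool → ℚ → ℚ
when b q = if b then q else 0ℚ

∑ : {A : Set} → List A → (A → ℚ) → ℚ
∑ xs f = sumQ (map f xs)

module _ {A : Set} where

  ∑-cong : (xs : List A) {f g : A → ℚ} → (∀ {x} → x ∈ xs → f x ≡ g x) → ∑ xs f ≡ ∑ xs g
  ∑-cong [] h = refl
  ∑-cong (x ∷ xs) h = cong₂ _+_ (h (here refl)) (∑-cong xs (h ∘ there))

  ∑-mono : (xs : List A) {f g : A → ℚ} → (∀ {x} → x ∈ xs → f x ≤ℚ g x) → ∑ xs f ≤ℚ ∑ xs g
  ∑-mono [] h = ℚ.≤-refl
  ∑-mono (x ∷ xs) h = ℚ.+-mono-≤ (h (here refl)) (∑-mono xs (h ∘ there))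

  ∑-+ : (xs : List A) (f g : A → ℚ) → ∑ xs (λ x → f x + g x) ≡ ∑ xs f + ∑ xs g
  ∑-+ [] f g = refl
  ∑-+ (x ∷ xs) f g = trans (cong (f x + g x +_) (∑-+ xs f g))
    (solve 4 (λ a b c d → (a :+ b) :+ (c :+ d) := (a :+ c) :+ (b :+ d)) refl (f x) (g x) (∑ xs f) (∑ xs g))
    where open +-*-Solver

  ∑-*ˡ : (xs : List A) (c : ℚ) (f : A → ℚ) → ∑ xs (λ x → c * f x) ≡ c * ∑ xs f
  ∑-*ˡ [] c f = sym (ℚ.*-zeroʳ c)
  ∑-*ˡ (x ∷ xs) c f = trans (cong (c * f x +_) (∑-*ˡ xs c f)) (sym (ℚ.*-distribˡ-+ c (f x) (∑ xs f)))

  ∑-*ʳ : (xs : List A) (c : ℚ) (f : A → ℚ) → ∑ xs (λ x → f x * c) ≡ ∑ xs f * c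
  ∑-*ʳ xs c f = trans (∑-cong xs (λ {x} _ → ℚ.*-comm (f x) c)) (trans (∑-*ˡ xs c f) (ℚ.*-comm c (∑ xs f)))

  ∑-const : (xs : List A) (c : ℚ) → ∑ xs (λ _ → c) ≡ ∑ xs (λ _ → 1ℚ) * c
  ∑-const xs c = trans (∑-cong xs (λ _ → sym (ℚ.*-identityˡ c))) (∑-*ʳ xs c (λ _ → 1ℚ))

  ∑-0 : (xs : List A) → ∑ xs (λ _ → 0ℚ) ≡ 0ℚ
  ∑-0 xs = trans (∑-const xs 0ℚ) (ℚ.*-zeroʳ (∑ xs (λ _ → 1ℚ)))

  ∑-nonNeg : (xs : List A) {f : A → ℚ} → (∀ {x} → x ∈ xs → 0ℚ ≤ℚ f x) → 0ℚ ≤ℚ ∑ xs f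
  ∑-nonNeg xs {f} h = subst (_≤ℚ ∑ xs f) (∑-0 xs) (∑-mono xs h)

  ∑-++ : (xs ys : List A) (f : A → ℚ) → ∑ (xs ++ ys) f ≡ ∑ xs f + ∑ ys f
  ∑-++ [] ys f = sym (ℚ.+-identityˡ (∑ ys f))
  ∑-++ (x ∷ xs) ys f = trans (cong (f x +_) (∑-++ xs ys f)) (sym (ℚ.+-assoc (f x) (∑ xs f) (∑ ys f)))

  ∑-filter : (p : A → Bool) (xs : List A) (f : A → ℚ) → ∑ (filterᵇ p xs) f ≡ ∑ xs (λ x → when (p x) (f x))
  ∑-filter p [] f = refl
  ∑-filter p (x ∷ xs) f with p x
  ... | true = cong (f x +_) (∑-filter p xs f)
  ... | false = trans (∑-filter p xs f) (sym (ℚ.+-identityˡ _))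

  ∑-↭ : {xs ys : List A} (f : A → ℚ) → xs ↭ ys → ∑ xs f ≡ ∑ ys f
  ∑-↭ f ↭-rfl = refl
  ∑-↭ f (prep x p) = cong (f x +_) (∑-↭ f p)
  ∑-↭ f (swap {xs} {ys} x y p) = trans (cong (λ q → f x + (f y + q)) (∑-↭ f p))
    (solve 3 (λ a b c → a :+ (b :+ c) := b :+ (a :+ c)) refl (f x) (f y) (∑ ys f))
    where open +-*-Solver
  ∑-↭ f (↭-trn p q) = trans (∑-↭ f p) (∑-↭ f q)

∑-swap : {A B : Set} (xs : List A) (ys : List B) (f : A → B → ℚ) →
  ∑ xs (λ x → ∑ ys (f x)) ≡ ∑ ys (λ y → ∑ xs (λ x → f x y))
∑-swap [] ys f = sym (∑-0 ys)
∑-swap (x ∷ xs) ys f =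
  trans (cong (∑ ys (f x) +_) (∑-swap xs ys f)) (sym (∑-+ ys (f x) (λ y → ∑ xs (λ x → f x y))))

∑-map : {A B : Set} (h : A → B) (xs : List A) (f : B → ℚ) → ∑ (map h xs) f ≡ ∑ xs (f ∘ h)
∑-map h [] f = refl
∑-map h (x ∷ xs) f = cong (f (h x) +_) (∑-map h xs f)

∑-concatMap : {A B : Set} (h : A → List B) (xs : List A) (f : B → ℚ) →
  ∑ (concatMap h xs) f ≡ ∑ xs (λ x → ∑ (h x) f)
∑-concatMap h [] f = refl
∑-concatMap h (x ∷ xs) f = trans (∑-++ (h x) (concatMap h xs) f) (cong (∑ (h x) f +_) (∑-concatMap h xs f))

*-nonNeg : ∀ {p q} → 0ℚ ≤ℚ p → 0ℚ ≤ℚ q → 0ℚ ≤ℚ p * q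
*-nonNeg {p} {q} 0≤p 0≤q =
  ℚ.nonNegative⁻¹ (p * q) {{ℚ.nonNeg*nonNeg⇒nonNeg p {{nonNegative 0≤p}} q {{nonNegative 0≤q}}}}

*-monoʳ : ∀ {p q} r → 0ℚ ≤ℚ r → p ≤ℚ q → p * r ≤ℚ q * r
*-monoʳ r 0≤r = ℚ.*-monoʳ-≤-nonNeg r {{nonNegative 0≤r}}

*-monoˡ : ∀ {p q} r → 0ℚ ≤ℚ r → p ≤ℚ q → r * p ≤ℚ r * q
*-monoˡ r 0≤r = ℚ.*-monoˡ-≤-nonNeg r {{nonNegative 0≤r}}

0≤1 : 0ℚ ≤ℚ 1ℚ
0≤1 = ℚ.nonNegative⁻¹ 1ℚ

when-nonNeg : ∀ b {q} → 0ℚ ≤ℚ q → 0ℚ ≤ℚ when b q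
when-nonNeg true h = h
when-nonNeg false h = ℚ.≤-refl

frac-nonNeg : ∀ a b → 0ℚ ≤ℚ frac a b
frac-nonNeg a zero = ℚ.≤-refl
frac-nonNeg a (suc b) = ℚ.nonNegative⁻¹ (frac a (suc b)) {{ℚ.normalize-nonNeg a (suc b)}}

frac-* : ∀ a b → 0 < b → frac a b * frac b 1 ≡ frac a 1
frac-* a (suc b) _ = ℚ.toℚᵘ-injective (begin
  ℚ.toℚᵘ (frac a (suc b) * frac (suc b) 1)
    ≈⟨ ℚ.toℚᵘ-homo-* (frac a (suc b)) (frac (suc b) 1) ⟩
  ℚ.toℚᵘ (frac a (suc b)) ℚᵘ.* ℚ.toℚᵘ (frac (suc b) 1)
    ≈⟨ ℚᵘ.*-cong (ℚ.toℚᵘ-fromℚᵘ (mkℚᵘ (ℤ.+ a) b)) (ℚ.toℚᵘ-fromℚᵘ (mkℚᵘ (ℤ.+ suc b) 0)) ⟩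
  mkℚᵘ (ℤ.+ a) b ℚᵘ.* mkℚᵘ (ℤ.+ suc b) 0
    ≈⟨ *≡* (trans (ℤ.*-identityʳ _) (cong (λ t → ℤ.+ a ℤ.* ℤ.+ suc t) (sym (ℕ.*-identityʳ b)))) ⟩
  mkℚᵘ (ℤ.+ a) 0
    ≈⟨ ℚᵘ.≃-sym (ℚ.toℚᵘ-fromℚᵘ (mkℚᵘ (ℤ.+ a) 0)) ⟩
  ℚ.toℚᵘ (frac a 1) ∎)
  where
  open ℚᵘ.≃-Reasoning

frac-suc : ∀ n → frac (suc n) 1 ≡ 1ℚ + frac n 1
frac-suc n = ℚ.toℚᵘ-injective (begin
  ℚ.toℚᵘ (frac (suc n) 1)
    ≈⟨ ℚ.toℚᵘ-fromℚᵘ (mkℚᵘ (ℤ.+ suc n) 0) ⟩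
  mkℚᵘ (ℤ.+ suc n) 0
    ≈⟨ *≡* (cong (λ t → (ℤ.+ 1 ℤ.+ t) ℤ.* ℤ.+ 1) (sym (ℤ.*-identityʳ (ℤ.+ n)))) ⟩
  ℚ.toℚᵘ 1ℚ ℚᵘ.+ mkℚᵘ (ℤ.+ n) 0
    ≈⟨ ℚᵘ.+-congʳ (ℚ.toℚᵘ 1ℚ) (ℚᵘ.≃-sym (ℚ.toℚᵘ-fromℚᵘ (mkℚᵘ (ℤ.+ n) 0))) ⟩
  ℚ.toℚᵘ 1ℚ ℚᵘ.+ ℚ.toℚᵘ (frac n 1)
    ≈⟨ ℚᵘ.≃-sym (ℚ.toℚᵘ-homo-+ 1ℚ (frac n 1)) ⟩
  ℚ.toℚᵘ (1ℚ + frac n 1) ∎)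
  where
  open ℚᵘ.≃-Reasoning

module _ {A : Set} where

  ∑-1 : (xs : List A) → ∑ xs (λ _ → 1ℚ) ≡ frac (length xs) 1
  ∑-1 [] = refl
  ∑-1 (x ∷ xs) = trans (cong (1ℚ +_) (∑-1 xs)) (sym (frac-suc (length xs)))

  ∑-count : (p : A → Bool) (xs : List A) → ∑ xs (λ x → when (p x) 1ℚ) ≡ frac (count p xs) 1
  ∑-count p xs = trans (sym (∑-filter p xs (λ _ → 1ℚ))) (∑-1 (filterᵇ p xs))

  frac-count : (p : A → Bool) (xs : List A) → 0 < length xs →
    frac (count p xs) (length xs) * ∑ xs (λ _ → 1ℚ) ≡ ∑ xs (λ x → when (p x) 1ℚ)
  frac-count p xs h = trans (cong (frac (count p xs) (length xs) *_) (∑-1 xs))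
    (trans (frac-* (count p xs) (length xs) h) (sym (∑-count p xs)))

  frac-1 : (xs : List A) → 0 < length xs → frac 1 (length xs) * ∑ xs (λ _ → 1ℚ) ≡ 1ℚ
  frac-1 xs h = trans (cong (frac 1 (length xs) *_) (∑-1 xs)) (frac-* 1 (length xs) h)

  frac-scale : ∀ a (xs : List A) → frac a (length xs) ≡ frac a 1 * frac 1 (length xs)
  frac-scale a [] = sym (ℚ.*-zeroʳ (frac a 1))
  frac-scale a xs@(_ ∷ _) = begin
    q                ≡⟨ sym (ℚ.*-identityʳ q) ⟩
    q * 1ℚ           ≡⟨ cong (q *_) (sym (frac-* 1 (length xs) (s≤s z≤n))) ⟩
    q * (r * N)      ≡⟨ solve 3 (λ q r N → q :* (r :* N) := (q :* N) :* r) refl q r N ⟩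
    (q * N) * r      ≡⟨ cong (_* r) (frac-* a (length xs) (s≤s z≤n)) ⟩
    frac a 1 * r ∎
    where
    open ≡-Reasoning
    open +-*-Solver
    q = frac a (length xs)
    r = frac 1 (length xs)
    N = frac (length xs) 1

≡true⇒T : ∀ {b} → b ≡ true → T b
≡true⇒T = Equivalence.from B.T-≡

T⇒≡true : ∀ {b} → T b → b ≡ true
T⇒≡true = Equivalence.to B.T-≡

≡-by-⇔ : ∀ {b c} → (b ≡ true → c ≡ true) → (c ≡ true → b ≡ true) → b ≡ c
≡-by-⇔ {true} to from = sym (to refl)
≡-by-⇔ {false} {true} to from = from refl
≡-by-⇔ {false} {false} to from = refl

¬true⇒false : ∀ {b} → ¬ b ≡ true → b ≡ false
¬true⇒false = B.¬-not

≡ᵇ-refl : ∀ n → (n ≡ᵇ n) ≡ true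
≡ᵇ-refl n = dec-true (n ℕ.≟ n) refl

≢⇒≡ᵇ : ∀ {m n} → m ≢ n → (m ≡ᵇ n) ≡ false
≢⇒≡ᵇ {m} {n} = dec-false (m ℕ.≟ n)

≡ᵇ⇒≡ : ∀ {m n} → (m ≡ᵇ n) ≡ true → m ≡ n
≡ᵇ⇒≡ {m} {n} e = ℕ.≡ᵇ⇒≡ m n (≡true⇒T e)

module _ {A : Set} {p : A → Bool} where

  any⁺ : ∀ {x xs} → x ∈ xs → p x ≡ true → any p xs ≡ true
  any⁺ (here refl) e rewrite e = refl
  any⁺ {xs = y ∷ _} (there i) e rewrite any⁺ i e = B.∨-zeroʳ (p y)

  any⁻ : ∀ xs → any p xs ≡ true → ∃ λ x → x ∈ xs × p x ≡ true
  any⁻ (x ∷ xs) e with p x in px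
  ... | true = x , here refl , px
  ... | false = case any⁻ xs e of λ (y , i , py) → y , there i , py

  all⁺ : ∀ xs → (∀ {x} → x ∈ xs → p x ≡ true) → all p xs ≡ true
  all⁺ [] h = refl
  all⁺ (x ∷ xs) h rewrite h (here refl) = all⁺ xs (h ∘ there)

  all⁻ : ∀ {x} xs → all p xs ≡ true → x ∈ xs → p x ≡ true
  all⁻ (x ∷ xs) e i with p x in px
  all⁻ (x ∷ xs) e (here refl) | true = px
  all⁻ (x ∷ xs) e (there i) | true = all⁻ xs e i

  ∈-filterᵇ⁺ : ∀ {x xs} → x ∈ xs → p x ≡ true → x ∈ filterᵇ p xs
  ∈-filterᵇ⁺ i e = ∈-filter⁺ (T? ∘ p) i (≡true⇒T e)

  ∈-filterᵇ⁻ : ∀ {x} xs → x ∈ filterᵇ p xs → x ∈ xs × p x ≡ true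
  ∈-filterᵇ⁻ xs i = case ∈-filter⁻ (T? ∘ p) {xs = xs} i of λ (j , t) → j , T⇒≡true t

≡⇒≟ : ∀ {b c} → b ≡ c → ⌊ b B.≟ c ⌋ ≡ true
≡⇒≟ {true} refl = refl
≡⇒≟ {false} refl = refl

filterᵇ-comm : {A : Set} (p q : A → Bool) (xs : List A) → filterᵇ p (filterᵇ q xs) ≡ filterᵇ q (filterᵇ p xs)
filterᵇ-comm p q [] = refl
filterᵇ-comm p q (x ∷ xs) with p x in px | q x in qx
... | true | true rewrite px | qx = cong (x ∷_) (filterᵇ-comm p q xs)
... | true | false rewrite qx = filterᵇ-comm p q xs
... | false | true rewrite px = filterᵇ-comm p q xs
... | false | false = filterᵇ-comm p q xs

infixl 6 _∖_
_∖_ : List ℕ → ℕ → List ℕ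
V ∖ y = filterᵇ (λ z → not (y ≡ᵇ z)) V

∈-∖⁺ : ∀ {y z V} → z ∈ V → y ≢ z → z ∈ V ∖ y
∈-∖⁺ i y≢z = ∈-filterᵇ⁺ i (cong not (≢⇒≡ᵇ y≢z))

∈-∖⁻ : ∀ y {z} V → z ∈ V ∖ y → z ∈ V × y ≢ z
∈-∖⁻ y V i with ∈-filterᵇ⁻ V i
... | j , e = j , λ { refl → contradiction (trans (sym e) (cong not (≡ᵇ-refl y))) λ () }

∉-∖ : ∀ y V → y ∉ V ∖ y
∉-∖ y V i = proj₂ (∈-∖⁻ y V i) refl

∖-∉ : ∀ {y V} → y ∉ V → V ∖ y ≡ V
∖-∉ {y} {V} y∉V = List.filter-all (T? ∘ (λ z → not (y ≡ᵇ z)))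
  (All.tabulate λ {z} z∈V → ≡true⇒T (cong not (≢⇒≡ᵇ {y} {z} λ { refl → y∉V z∈V })))

∖-head : ∀ {y V} → y ∉ V → (y ∷ V) ∖ y ≡ V
∖-head {y} y∉V rewrite ≡ᵇ-refl y = ∖-∉ y∉V

∖-there : ∀ {y x} V → y ≢ x → (x ∷ V) ∖ y ≡ x ∷ (V ∖ y)
∖-there V y≢x rewrite ≢⇒≡ᵇ y≢x = refl

Unique-∖ : ∀ y {V} → Unique V → Unique (V ∖ y)
Unique-∖ y = Unique.filter⁺ (T? ∘ (λ z → not (y ≡ᵇ z)))

Unique-∉ : ∀ {x : ℕ} {V} → Unique (x ∷ V) → x ∉ V
Unique-∉ (h ∷ _) i = All.lookup h i refl

↭-∖ : ∀ {y V} → Unique V → y ∈ V → V ↭ y ∷ (V ∖ y)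
↭-∖ {y} {y ∷ V} u (here refl) rewrite ∖-head (Unique-∉ u) = ↭-rfl
↭-∖ {y} {x ∷ V} u@(_ ∷ u′) (there i) rewrite ∖-there {y} {x} V (λ { refl → Unique-∉ u i }) =
  ↭-trn (prep x (↭-∖ u′ i)) (swap x y ↭-rfl)

memNat⁺ : ∀ {x V} → x ∈ V → memNat x V ≡ true
memNat⁺ {x} i = any⁺ i (≡ᵇ-refl x)

memNat⁻ : ∀ {x} V → memNat x V ≡ true → x ∈ V
memNat⁻ V e with any⁻ V e
... | y , i , e′ = subst (_∈ V) (sym (≡ᵇ⇒≡ e′)) i

∉⇒memNat : ∀ {x} V → x ∉ V → memNat x V ≡ false
∉⇒memNat V x∉V = ¬true⇒false (x∉V ∘ memNat⁻ V)

-- Valuations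

Valuation : Set
Valuation = ℕ → Bool

at : Valuation → ℕ → Literal
at a y = lit y (a y)

litV : Valuation → Literal → Bool
litV a l = ⌊ a (var l) B.≟ pos l ⌋

evC : Valuation → Clause → Bool
evC a = any (litV a)

ev : Valuation → List Clause → Bool
ev a = all (evC a)

_[_≔_] : Valuation → ℕ → Bool → Valuation
(a [ x ≔ b ]) z = if x ≡ᵇ z then b else a z

≔-same : ∀ (a : Valuation) x b → (a [ x ≔ b ]) x ≡ b
≔-same a x b rewrite ≡ᵇ-refl x = refl

≔-other : ∀ (a : Valuation) {x z} b → x ≢ z → (a [ x ≔ b ]) z ≡ a z
≔-other a b x≢z rewrite ≢⇒≡ᵇ x≢z = refl

litV-at : ∀ a y → litV a (at a y) ≡ true
litV-at a y = ≡⇒≟ refl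

litV⇒at : ∀ {a} l → litV a l ≡ true → l ≡ at a (var l)
litV⇒at {a} (lit x b) e with a x B.≟ b
... | yes refl = refl

litV-≔ : ∀ a l → litV (a [ var l ≔ pos l ]) l ≡ true
litV-≔ a l = ≡⇒≟ (≔-same a (var l) (pos l))

litV-cong : ∀ (a b : Valuation) l → a (var l) ≡ b (var l) → litV a l ≡ litV b l
litV-cong a b l e = cong (λ c → ⌊ c B.≟ pos l ⌋) e

litEq-refl : ∀ l → litEq l l ≡ true
litEq-refl (lit x b) rewrite ≡ᵇ-refl x = ≡⇒≟ {b} refl

litEq⇒≡ : ∀ l m → litEq l m ≡ true → l ≡ m
litEq⇒≡ (lit x b) (lit y c) e with x ≡ᵇ y in x≡y | b B.≟ c
... | true | yes refl = cong (λ z → lit z b) (≡ᵇ⇒≡ x≡y)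

≢⇒litEq : ∀ {l m} → l ≢ m → litEq l m ≡ false
≢⇒litEq l≢m = ¬true⇒false (l≢m ∘ litEq⇒≡ _ _)

memLit⁺ : ∀ {l C} → l ∈ C → memLit l C ≡ true
memLit⁺ {l} i = any⁺ i (litEq-refl l)

memLit⁻ : ∀ {l} C → memLit l C ≡ true → l ∈ C
memLit⁻ {l} C e with any⁻ C e
... | m , i , e′ = subst (_∈ C) (sym (litEq⇒≡ l m e′)) i

-- Restriction of clause lists

drop¬ : Literal → Clause → Clause
drop¬ l = filterᵇ (λ m → not (litEq (neg l) m))

_↾_ : List Clause → Literal → List Clause
K ↾ l = map (drop¬ l) (filterᵇ (λ C → not (memLit l C)) K)

memLit-drop¬ : ∀ {l m} → neg l ≢ m → ∀ C → memLit m (drop¬ l C) ≡ memLit m C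
memLit-drop¬ {l} {m} l̄≢m C = ≡-by-⇔
  (λ e → memLit⁺ {m} (proj₁ (∈-filterᵇ⁻ C (memLit⁻ (drop¬ l C) e))))
  (λ e → memLit⁺ {m} (∈-filterᵇ⁺ (memLit⁻ C e) (cong not (≢⇒litEq {neg l} {m} l̄≢m))))

↾-comm : ∀ {l m} → var l ≢ var m → ∀ K → (K ↾ l) ↾ m ≡ (K ↾ m) ↾ l
↾-comm l≢m [] = refl
↾-comm {l} {m} l≢m (C ∷ K) with memLit l C in lC | memLit m C in mC
... | true | true = ↾-comm l≢m K
... | true | false
  rewrite trans (memLit-drop¬ {m} {l} (λ e → l≢m (sym (cong var e))) C) lC = ↾-comm l≢m K
... | false | true
  rewrite trans (memLit-drop¬ {l} {m} (λ e → l≢m (cong var e)) C) mC = ↾-comm l≢m K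
... | false | false
  rewrite trans (memLit-drop¬ {m} {l} (λ e → l≢m (sym (cong var e))) C) lC
        | trans (memLit-drop¬ {l} {m} (λ e → l≢m (cong var e)) C) mC
  = cong₂ _∷_ (filterᵇ-comm _ _ C) (↾-comm l≢m K)

restrict-comm : ∀ {l m} → var l ≢ var m → ∀ F → restrict (restrict F l) m ≡ restrict (restrict F m) l
restrict-comm l≢m F = cong₂ cnf (filterᵇ-comm _ _ (vars F)) (↾-comm l≢m (clauses F))

litV-neg : ∀ a l → litV a l ≡ true → litV a (neg l) ≡ false
litV-neg a (lit x b) e with a x
litV-neg a (lit x true) e | true = refl
litV-neg a (lit x false) e | false = refl

evC-drop¬ : ∀ a l → litV a l ≡ true → ∀ C → evC a (drop¬ l C) ≡ evC a C
evC-drop¬ a l al C = ≡-by-⇔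
  (λ e → case any⁻ (drop¬ l C) e of λ (m , i , am) → any⁺ (proj₁ (∈-filterᵇ⁻ C i)) am)
  (λ e → case any⁻ C e of λ (m , i , am) → any⁺ (∈-filterᵇ⁺ i (cong not (≢⇒litEq {neg l} {m}
     λ { refl → contradiction (trans (sym am) (litV-neg a l al)) λ () }))) am)

ev-↾ : ∀ a l → litV a l ≡ true → ∀ K → ev a (K ↾ l) ≡ ev a K
ev-↾ a l al [] = refl
ev-↾ a l al (C ∷ K) with memLit l C in lC
... | true rewrite any⁺ {p = litV a} (memLit⁻ C lC) al = ev-↾ a l al K
... | false = cong₂ _∧_ (evC-drop¬ a l al C) (ev-↾ a l al K)

Unique-map-filterᵇ : {A : Set} (f : A → ℕ) (p : A → Bool) (xs : List A) → Unique (map f xs) → Unique (map f (filterᵇ p xs))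
Unique-map-filterᵇ f p xs u = AllPairs.map⁺ (AllPairs.filter⁺ (T? ∘ p) (AllPairs.map⁻ u))

Over : List ℕ → List Clause → Set
Over V = All (All (λ l → var l ∈ V))

WF⇒Over : ∀ {F} → WF F → Over (vars F) (clauses F)
WF⇒Over (_ , h) = All.map proj₁ h

WF-restrict : ∀ {F} l → WF F → WF (restrict F l)
WF-restrict {F} l (u , h) = Unique-∖ (var l) u , All.map⁺ (All.tabulate clauseWF)
  where
  ¬l∈ : ∀ {C} → memLit l C ≡ false → ∀ {m} → m ∈ C → m ≢ l
  ¬l∈ l∉C i refl = contradiction (trans (sym (memLit⁺ i)) l∉C) λ ()

  clauseWF : ∀ {C} → C ∈ filterᵇ (λ C → not (memLit l C)) (clauses F) →
    All (λ m → var m ∈ vars (restrict F l)) (drop¬ l C) × Unique (map var (drop¬ l C))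
  clauseWF {C} i with ∈-filterᵇ⁻ (clauses F) i
  ... | j , e with All.lookup h j
  ... | ov , uC = All.tabulate litWF , Unique-map-filterᵇ var _ C uC
    where
    l∉C : memLit l C ≡ false
    l∉C = B.not-injective e

    lit≡ : ∀ {l m} → var l ≡ var m → m ≢ l → neg l ≢ m → ∀ {A : Set} → A
    lit≡ {lit x true} {lit x true} refl p q = ⊥-elim (p refl)
    lit≡ {lit x true} {lit x false} refl p q = ⊥-elim (q refl)
    lit≡ {lit x false} {lit x true} refl p q = ⊥-elim (q refl)
    lit≡ {lit x false} {lit x false} refl p q = ⊥-elim (p refl)

    litWF : ∀ {m} → m ∈ drop¬ l C → var m ∈ vars F ∖ var l
    litWF {m} k with ∈-filterᵇ⁻ C k
    ... | k′ , e′ = ∈-∖⁺ (All.lookup ov k′) λ v≡ → lit≡ v≡ (¬l∈ l∉C k′)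
      λ { refl → contradiction (trans (sym (litEq-refl (neg l))) (B.not-injective e′)) λ () }

LeK-restrict : ∀ {k F} l → LeK k F → LeK k (restrict F l)
LeK-restrict {k} {F} l h = All.map⁺ (All.map (λ {C} → ℕ.≤-trans (List.length-filter (T? ∘ _) C)) (All.filter⁺ (T? ∘ _) h))

-- Assignments as lists and as valuations

module _ (a : Valuation) where

  memLit-at : ∀ {V} m → var m ∈ V → memLit m (map (at a) V) ≡ litV a m
  memLit-at {V} m i = ≡-by-⇔
    (λ e → case ∈-map⁻ (at a) (memLit⁻ {m} (map (at a) V) e) of λ { (y , _ , refl) → litV-at a y })
    (λ e → memLit⁺ {m} (subst (_∈ map (at a) V) (sym (litV⇒at {a} m e)) (∈-map⁺ (at a) i)))

  at-∈-allAssign : ∀ V → map (at a) V ∈ allAssign V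
  at-∈-allAssign [] = here refl
  at-∈-allAssign (x ∷ V) = ∈-concatMap⁺ _ (lose (at-∈-allAssign V) (at∈ (a x)))
    where
    at∈ : ∀ b → (lit x b ∷ map (at a) V) ∈ (lit x true ∷ map (at a) V) ∷ (lit x false ∷ map (at a) V) ∷ []
    at∈ true = here refl
    at∈ false = there (here refl)

allAssign⁻ : ∀ {V α} → Unique V → α ∈ allAssign V → ∃ λ a → α ≡ map (at a) V
allAssign⁻ {[]} u (here refl) = (λ _ → true) , refl
allAssign⁻ {x ∷ V} u@(_ ∷ u′) i with find (∈-concatMap⁻ (λ α → (lit x true ∷ α) ∷ (lit x false ∷ α) ∷ []) {xs = allAssign V} i)
... | α′ , j , k with allAssign⁻ u′ j
... | a , refl = case k of λ where
    (here refl) → a [ x ≔ true ] , cons true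
    (there (here refl)) → a [ x ≔ false ] , cons false
  where
  cons : ∀ b → lit x b ∷ map (at a) V ≡ map (at (a [ x ≔ b ])) (x ∷ V)
  cons b = cong₂ _∷_ (cong (lit x) (sym (≔-same a x b)))
    (List.map-cong-local (All.tabulate λ {y} y∈ → cong (lit y) (sym (≔-other a {x} {y} b λ { refl → Unique-∉ u y∈ }))))

Agree : List ℕ → Assignment → Valuation → Set
Agree V α a = ∀ m → var m ∈ V → memLit m α ≡ litV a m

allAssign-agree : ∀ {V α} → Unique V → α ∈ allAssign V → Agree V α (valueOf α)
allAssign-agree {V} u i m m∈ with allAssign⁻ u i
... | a , refl = trans (memLit-at a m m∈) (litV-cong a (valueOf (map (at a) V)) m (sym value))
  where
  litV-true : ∀ b → ⌊ b B.≟ true ⌋ ≡ b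
  litV-true true = refl
  litV-true false = refl
  value : valueOf (map (at a) V) (var m) ≡ a (var m)
  value = trans (memLit-at a (lit (var m) true) m∈) (litV-true (a (var m)))

any-cong : {A : Set} {p q : A → Bool} (xs : List A) → (∀ {x} → x ∈ xs → p x ≡ q x) → any p xs ≡ any q xs
any-cong [] h = refl
any-cong (x ∷ xs) h = cong₂ _∨_ (h (here refl)) (any-cong xs (h ∘ there))

all-cong : {A : Set} {p q : A → Bool} (xs : List A) → (∀ {x} → x ∈ xs → p x ≡ q x) → all p xs ≡ all q xs
all-cong [] h = refl
all-cong (x ∷ xs) h = cong₂ _∧_ (h (here refl)) (all-cong xs (h ∘ there))

satAll-ev : ∀ {V} α a K → Over V K → Agree V α a → satAll α K ≡ ev a K
satAll-ev α a K o ag = all-cong K λ {C} C∈ → any-cong C λ m∈ → ag _ (All.lookup (All.lookup o C∈) m∈)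

ev-cong : ∀ {V} (a b : Valuation) K → Over V K → (∀ {y} → y ∈ V → a y ≡ b y) → ev a K ≡ ev b K
ev-cong a b K o h = all-cong K λ {C} C∈ → any-cong C λ {m} m∈ → litV-cong a b m (h (All.lookup (All.lookup o C∈) m∈))

module _ {F : CNF} (wf : WF F) where

  sat⁺ : ∀ a → ev a (clauses F) ≡ true → map (at a) (vars F) ∈ sat F
  sat⁺ a e = ∈-filterᵇ⁺ (at-∈-allAssign a (vars F))
    (trans (satAll-ev (map (at a) (vars F)) a (clauses F) (WF⇒Over {F} wf) (memLit-at a)) e)

  sat⇒agree : ∀ {α} → α ∈ sat F → Agree (vars F) α (valueOf α)
  sat⇒agree i = allAssign-agree (proj₁ wf) (proj₁ (∈-filterᵇ⁻ (allAssign (vars F)) i))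

  sat⇒ev : ∀ {α} → α ∈ sat F → ev (valueOf α) (clauses F) ≡ true
  sat⇒ev {α} i = trans (sym (satAll-ev α (valueOf α) (clauses F) (WF⇒Over {F} wf) (sat⇒agree i))) (proj₂ (∈-filterᵇ⁻ (allAssign (vars F)) i))

  satisfiable⁺ : ∀ a → ev a (clauses F) ≡ true → Satisfiable F
  satisfiable⁺ a e = ∈-length (sat⁺ a e)

  satisfiable⁻ : Satisfiable F → ∃ λ a → ev a (clauses F) ≡ true
  satisfiable⁻ h with sat F in eq
  ... | α ∷ _ = valueOf α , sat⇒ev (subst (α ∈_) (sym eq) (here refl))

∈-literalsOver⁺ : ∀ {l V} → var l ∈ V → l ∈ literalsOver V
∈-literalsOver⁺ {lit x true} i = ∈-concatMap⁺ _ (lose i (here refl))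
∈-literalsOver⁺ {lit x false} i = ∈-concatMap⁺ _ (lose i (there (here refl)))

∈-literalsOver⁻ : ∀ {l} V → l ∈ literalsOver V → var l ∈ V
∈-literalsOver⁻ V i with find (∈-concatMap⁻ (λ x → lit x true ∷ lit x false ∷ []) {xs = V} i)
... | x , j , here refl = j
... | x , j , there (here refl) = j

∑-literalsOver : ∀ V (f : Literal → ℚ) → ∑ (literalsOver V) f ≡ ∑ V (λ y → f (lit y true) + f (lit y false))
∑-literalsOver V f = trans (∑-concatMap _ V f) (∑-cong V λ {y} _ → cong (f (lit y true) +_) (ℚ.+-identityʳ _))

satisfiableᵇ : CNF → Bool
satisfiableᵇ F = 0 ℕ.<ᵇ length (sat F)

satisfiableᵇ⁻ : ∀ F → satisfiableᵇ F ≡ true → Satisfiable F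
satisfiableᵇ⁻ F e = ℕ.<ᵇ⇒< 0 (length (sat F)) (≡true⇒T e)

satisfiableᵇ⁺ : ∀ {F} → Satisfiable F → satisfiableᵇ F ≡ true
satisfiableᵇ⁺ h = T⇒≡true (ℕ.<⇒<ᵇ h)

module _ {F : CNF} (wf : WF F) where

  restrict-satisfiable⁺ : ∀ a l → litV a l ≡ true → ev a (clauses F) ≡ true → Satisfiable (restrict F l)
  restrict-satisfiable⁺ a l al e = satisfiable⁺ (WF-restrict {F} l wf) a (trans (ev-↾ a l al (clauses F)) e)

  restrict-satisfiable⁻ : ∀ {l} → Satisfiable (restrict F l) → ∃ λ a → litV a l ≡ true × ev a (clauses F) ≡ true
  restrict-satisfiable⁻ {l} h with satisfiable⁻ (WF-restrict {F} l wf) h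
  ... | b , e = a , litV-≔ b l , trans (sym (ev-↾ a l (litV-≔ b l) (clauses F)))
      (trans (ev-cong a b (clauses (restrict F l)) (WF⇒Over {restrict F l} (WF-restrict {F} l wf))
        (λ {y} y∈ → ≔-other b {var l} {y} (pos l) λ { refl → ∉-∖ (var l) (vars F) y∈ })) e)
    where a = b [ var l ≔ pos l ]

  SL⁻ : ∀ {l} → l ∈ SL F → var l ∈ vars F × Satisfiable (restrict F l)
  SL⁻ {l} i with ∈-filterᵇ⁻ (literalsOver (vars F)) i
  ... | j , e = ∈-literalsOver⁻ (vars F) j , satisfiableᵇ⁻ (restrict F l) e

  SL⁺ : ∀ a l → litV a l ≡ true → ev a (clauses F) ≡ true → var l ∈ vars F → l ∈ SL F
  SL⁺ a l al e i = ∈-filterᵇ⁺ (∈-literalsOver⁺ i) (satisfiableᵇ⁺ {restrict F l} (restrict-satisfiable⁺ a l al e))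

  ∑-SL : (f : Literal → ℚ) → ∑ (SL F) f ≡ ∑ (vars F) (λ y →
    when (satisfiableᵇ (restrict F (lit y true))) (f (lit y true)) + when (satisfiableᵇ (restrict F (lit y false))) (f (lit y false)))
  ∑-SL f = trans (∑-filter _ (literalsOver (vars F)) f) (∑-literalsOver (vars F) _)

  NonFrozen : ℕ → Set
  NonFrozen x = ∃ λ a → ∃ λ b → (ev a (clauses F) ≡ true × a x ≡ true) × (ev b (clauses F) ≡ true × b x ≡ false)

  nonFrozen⁻ : ∀ {x} → x ∈ vars F → frozenB F x ≡ false → NonFrozen x
  nonFrozen⁻ {x} x∈ e
    with any (λ α → satLit α (lit x true)) (sat F) in e₁ | any (λ α → satLit α (lit x false)) (sat F) in e₂
  ... | true | true with any⁻ (sat F) e₁ | any⁻ (sat F) e₂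
  ... | α , i , xα | β , j , xβ = valueOf α , valueOf β
      , (sat⇒ev wf i , xα)
      , (sat⇒ev wf j , sym (cong pos (litV⇒at {valueOf β} (lit x false) (trans (sym (sat⇒agree wf j (lit x false) x∈)) xβ))))

  nonFrozen⁺ : ∀ {x} → x ∈ vars F → NonFrozen x → frozenB F x ≡ false
  nonFrozen⁺ {x} x∈ (a , b , (ea , ax) , (eb , bx))
    rewrite any⁺ {p = λ α → satLit α (lit x true)} (sat⁺ wf a ea) (trans (memLit-at a (lit x true) x∈) (≡⇒≟ ax))
          | any⁺ {p = λ α → satLit α (lit x false)} (sat⁺ wf b eb) (trans (memLit-at b (lit x false) x∈) (≡⇒≟ bx))
    = refl

frozen-restrict : ∀ {F x} l → WF F → Satisfiable (restrict F l) → x ∈ vars (restrict F l) →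
  frozenB F x ≡ true → frozenB (restrict F l) x ≡ true
frozen-restrict {F} {x} l wf h x∈ fr with frozenB (restrict F l) x in e
... | true = refl
... | false = case nonFrozen⁻ wf′ x∈ e of λ (a , b , (ea , ax) , (eb , bx)) →
      contradiction (trans (sym fr) (nonFrozen⁺ wf (proj₁ (∈-∖⁻ (var l) (vars F) x∈))
        (ext a , ext b , (lift a ea , trans (≔-other a {var l} {x} (pos l) l≢x) ax) , (lift b eb , trans (≔-other b {var l} {x} (pos l) l≢x) bx)))) λ ()
  where
  wf′ = WF-restrict {F} l wf
  l≢x : var l ≢ x
  l≢x = proj₂ (∈-∖⁻ (var l) (vars F) x∈)
  ext : Valuation → Valuation
  ext a = a [ var l ≔ pos l ]
  lift : ∀ a → ev a (clauses F ↾ l) ≡ true → ev (ext a) (clauses F) ≡ true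
  lift a e = trans (sym (ev-↾ (ext a) l (litV-≔ a l) (clauses F)))
      (trans (ev-cong (ext a) a (clauses (restrict F l)) (WF⇒Over {restrict F l} wf′)
        (λ {y} y∈ → ≔-other a {var l} {y} (pos l) λ { refl → ∉-∖ (var l) (vars F) y∈ })) e)

-- s-implied literals

subs⁻ : {A : Set} → ∀ s (cs : List A) {K} → K ∈ subs s cs → K ⊆ cs × length K ≤ s
subs⁻ s [] (here refl) = [] , z≤n
subs⁻ zero (c ∷ cs) (here refl) = minimum _ , z≤n
subs⁻ (suc s) (c ∷ cs) i with ∈-++⁻ (subs (suc s) cs) i
... | inj₁ j = case subs⁻ (suc s) cs j of λ (p , q) → c ∷ʳ p , q
... | inj₂ j with ∈-map⁻ (c ∷_) j
... | K′ , k , refl = case subs⁻ s cs k of λ (p , q) → refl ∷ p , s≤s q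

subs⁺ : {A : Set} → ∀ s {cs K : List A} → K ⊆ cs → length K ≤ s → K ∈ subs s cs
subs⁺ s [] q = here refl
subs⁺ zero {K = []} (c ∷ʳ p) q = here refl
subs⁺ (suc s) (c ∷ʳ p) q = ∈-++⁺ˡ (subs⁺ (suc s) p q)
subs⁺ (suc s) {c ∷ cs} (refl ∷ p) (s≤s q) = ∈-++⁺ʳ (subs (suc s) cs) (∈-map⁺ (c ∷_) (subs⁺ s p q))

modusPonens : ∀ {b c} → not b ∨ c ≡ true → b ≡ true → c ≡ true
modusPonens h refl = h

Implied : ℕ → CNF → Literal → Set
Implied s F l = ∃ λ K → (K ⊆ clauses F × length K ≤ s) × (∀ a → ev a K ≡ true → litV a l ≡ true)

module _ {F : CNF} {s : ℕ} {l : Literal} (wf : WF F) (l∈ : var l ∈ vars F) where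

  private
    over : ∀ {K} → K ⊆ clauses F → Over (vars F) K
    over p = Sub.All-resp-⊆ p (WF⇒Over {F} wf)

  implied⁻ : impliedB s F l ≡ true → Implied s F l
  implied⁻ e with any⁻ (subs s (clauses F)) e
  ... | K , i , e′ with subs⁻ s (clauses F) i
  ... | p , q = K , (p , q) , entails
    where
    entails : ∀ a → ev a K ≡ true → litV a l ≡ true
    entails a aK = trans (sym (memLit-at a l l∈))
      (modusPonens (all⁻ (allAssign (vars F)) e′ (at-∈-allAssign a (vars F)))
        (trans (satAll-ev (map (at a) (vars F)) a K (over p) (memLit-at a)) aK))

  implied⁺ : Implied s F l → impliedB s F l ≡ true
  implied⁺ (K , (p , q) , entails) = any⁺ (subs⁺ s p q) (all⁺ (allAssign (vars F)) entailed)
    where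
    entailed : ∀ {α} → α ∈ allAssign (vars F) → not (satAll α K) ∨ satLit α l ≡ true
    entailed {α} i with satAll α K in e
    ... | false = refl
    ... | true = trans (ag l l∈) (entails (valueOf α) (trans (sym (satAll-ev α (valueOf α) K (over p) ag)) e))
      where ag = allAssign-agree (proj₁ wf) i

  implied-sound : ∀ a → ev a (clauses F) ≡ true → impliedB s F l ≡ true → litV a l ≡ true
  implied-sound a e i with implied⁻ i
  ... | K , (p , _) , entails = entails a (all⁺ K λ C∈ → all⁻ (clauses F) e (lookup p C∈))

implied-restrict : ∀ {F s l} m → WF F → var l ∈ vars (restrict F m) →
  impliedB s F l ≡ true → impliedB s (restrict F m) l ≡ true
implied-restrict {F} {s} {l} m wf l∈ i with implied⁻ wf (proj₁ (∈-∖⁻ (var m) (vars F) l∈)) i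
... | K , (p , q) , entails = implied⁺ (WF-restrict {F} m wf) l∈ (K ↾ m
    , (Sub.map⁺ (drop¬ m) (Sub.filter⁺ (T? ∘ _) (T? ∘ _) (λ { refl t → t }) p)
      , ℕ.≤-trans (ℕ.≤-reflexive (List.length-map (drop¬ m) (filterᵇ _ K))) (ℕ.≤-trans (List.length-filter (T? ∘ _) K) q))
    , λ a aK → trans (litV-cong a (a [ var m ≔ pos m ]) l (sym (≔-other a {var m} {var l} (pos m) (proj₂ (∈-∖⁻ (var m) (vars F) l∈)))))
        (entails (a [ var m ≔ pos m ]) (trans (sym (ev-↾ (a [ var m ≔ pos m ]) m (litV-≔ a m) K)) (trans (ev-cong (a [ var m ≔ pos m ]) a (K ↾ m) over (λ {y} y∈ →
           ≔-other a {var m} {y} (pos m) λ { refl → ∉-∖ (var m) (vars F) y∈ })) aK))))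
  where
  over : Over (vars (restrict F m)) (K ↾ m)
  over = Sub.All-resp-⊆ (Sub.map⁺ (drop¬ m) (Sub.filter⁺ (T? ∘ _) (T? ∘ _) (λ { refl t → t }) p))
    (WF⇒Over {restrict F m} (WF-restrict {F} m wf))

-- Runs of PPSZ along a satisfying valuation

data Path (a : Valuation) : CNF → CNF → Set where
  done : ∀ {F} → Path a F F
  step : ∀ {F H} y → Path a (restrict F (at a y)) H → Path a F H

module _ {a : Valuation} where

  path-trans : ∀ {F G H} → Path a F G → Path a G H → Path a F H
  path-trans done q = q
  path-trans (step y p) q = step y (path-trans p q)

  path-vars : ∀ {F H z} → Path a F H → z ∈ vars H → z ∈ vars F
  path-vars done i = i
  path-vars {F} (step y p) i = proj₁ (∈-∖⁻ y (vars F) (path-vars p i))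

  path-restrict : ∀ {F H} y → Path a F H → Path a (restrict F (at a y)) (restrict H (at a y))
  path-restrict y done = done
  path-restrict {F} {H} y (step z p) with z ℕ.≟ y
  ... | yes refl = path-trans p (step y done)
  ... | no z≢y = step z (subst (λ G → Path a G (restrict H (at a y)))
                            (restrict-comm {at a z} {at a y} z≢y F) (path-restrict y p))

  path-absorb : ∀ {F H} y → y ∈ vars F → y ∉ vars H → Path a F H → Path a (restrict F (at a y)) H
  path-absorb y i j done = contradiction i j
  path-absorb {F} {H} y i j (step z p) with z ℕ.≟ y
  ... | yes refl = p
  ... | no z≢y = step z (subst (λ G → Path a G H)
                            (restrict-comm {at a z} {at a y} z≢y F) (path-absorb y (∈-∖⁺ i z≢y) j p))

  path-implied : ∀ {F H s l} → WF F → Path a F H → var l ∈ vars H → impliedB s F l ≡ true → impliedB s H l ≡ true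
  path-implied wf done i e = e
  path-implied {F} wf (step y p) i e =
    path-implied (WF-restrict {F} (at a y) wf) p i (implied-restrict (at a y) wf (path-vars p i) e)

Models : Valuation → CNF → Set
Models a F = WF F × ev a (clauses F) ≡ true

models-restrict : ∀ {a F} y → Models a F → Models a (restrict F (at a y))
models-restrict {a} {F} y (wf , e) = WF-restrict {F} (at a y) wf , trans (ev-↾ a (at a y) (litV-at a y) (clauses F)) e

models-path : ∀ {a F H} → Models a F → Path a F H → Models a H
models-path m done = m
models-path {a} {F} m (step y p) = models-path (models-restrict {a} {F} y m) p

Closed : ℕ → CNF → Set
Closed s F = ∀ {l} → var l ∈ vars F → impliedB s F l ≡ false

module _ {A : Set} {p : A → Bool} where

  firstB-nothing : ∀ {x} xs → firstB p xs ≡ nothing → x ∈ xs → p x ≡ false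
  firstB-nothing (x ∷ xs) e i with p x in px
  firstB-nothing (x ∷ xs) e (here refl) | false = px
  firstB-nothing (x ∷ xs) e (there i) | false = firstB-nothing xs e i

  firstB-just : ∀ {x} xs → firstB p xs ≡ just x → x ∈ xs × p x ≡ true
  firstB-just (x ∷ xs) e with p x in px
  firstB-just (x ∷ xs) refl | true = here refl , px
  ... | false = case firstB-just xs e of λ (i , q) → there i , q

  firstB-none : ∀ xs → (∀ {x} → x ∈ xs → p x ≡ false) → firstB p xs ≡ nothing
  firstB-none [] h = refl
  firstB-none (x ∷ xs) h rewrite h (here refl) = firstB-none xs (h ∘ there)

∖-length : ∀ {y V} → y ∈ V → length (V ∖ y) < length V
∖-length {y} {V} i = List.filter-notAll (T? ∘ _) V (lose i λ t → contradiction (T⇒≡true t) λ e →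
  contradiction (trans (sym e) (cong not (≡ᵇ-refl y))) λ ())

propagate-closed : ∀ n {s} F → length (vars F) < n → Closed s (propagate n s F)
propagate-closed (suc n) {s} F (s≤s h) with firstB (impliedB s F) (literalsOver (vars F)) in e
... | nothing = λ i → firstB-nothing (literalsOver (vars F)) e (∈-literalsOver⁺ i)
... | just l with firstB-just (literalsOver (vars F)) e
... | i , _ = propagate-closed n (restrict F l) (ℕ.<-≤-trans (∖-length (∈-literalsOver⁻ (vars F) i)) h)

propagate-id : ∀ n {s F} → Closed s F → propagate n s F ≡ F
propagate-id zero c = refl
propagate-id (suc n) {s} {F} c
  rewrite firstB-none {p = impliedB s F} (literalsOver (vars F)) (λ i → c (∈-literalsOver⁻ (vars F) i)) = refl

propagate-vars : ∀ n {s z} F → z ∈ vars (propagate n s F) → z ∈ vars F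
propagate-vars zero F i = i
propagate-vars (suc n) {s} F i with firstB (impliedB s F) (literalsOver (vars F))
... | nothing = i
... | just l = proj₁ (∈-∖⁻ (var l) (vars F) (propagate-vars n (restrict F l) i))

module _ {a : Valuation} where

  implied-at : ∀ {F s l} → Models a F → firstB (impliedB s F) (literalsOver (vars F)) ≡ just l →
    l ≡ at a (var l) × var l ∈ vars F × impliedB s F l ≡ true
  implied-at {F} {s} {l} (wf , m) e with firstB-just (literalsOver (vars F)) e
  ... | i , imp = litV⇒at {a} l (implied-sound wf l∈ a m imp) , l∈ , imp
    where l∈ = ∈-literalsOver⁻ (vars F) i

  propagate-path : ∀ n {s F} → Models a F → Path a F (propagate n s F)
  propagate-path zero m = done
  propagate-path (suc n) {s} {F} m with firstB (impliedB s F) (literalsOver (vars F)) in e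
  ... | nothing = done
  ... | just l with implied-at {F} {s} m e
  ... | l≡ , _ , _ = step (var l) (subst (λ l′ → Path a (restrict F (at a (var l))) (propagate n s (restrict F l′))) (sym l≡)
                         (propagate-path n (models-restrict {a} {F} (var l) m)))

  -- Propagation is confluent: its result is the least closed restriction.
  propagate-least : ∀ n {s F K} → Models a F → Closed s K → Path a F K → Path a (propagate n s F) K
  propagate-least zero m c p = p
  propagate-least (suc n) {s} {F} {K} m c p with firstB (impliedB s F) (literalsOver (vars F)) in e
  ... | nothing = p
  ... | just l with implied-at {F} {s} m e
  ... | l≡ , l∈ , imp = subst (λ l′ → Path a (propagate n s (restrict F l′)) K) (sym l≡)
      (propagate-least n (models-restrict {a} {F} (var l) m) c (path-absorb (var l) l∈ l∉ p))
    where
    l∉ : var l ∉ vars K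
    l∉ i = contradiction (trans (sym (path-implied (proj₁ m) p i imp)) (c i)) λ ()

closure : ℕ → CNF → CNF
closure s F = propagate (suc (length (vars F))) s F

closure-closed : ∀ s F → Closed s (closure s F)
closure-closed s F = propagate-closed _ F ℕ.≤-refl

data Padded (y : ℕ) : List ℕ → List ℕ → Set where
  nil  : Padded y [] []
  keep : ∀ {π ρ} z → Padded y π ρ → Padded y (z ∷ π) (z ∷ ρ)
  pad  : ∀ {π ρ} → Padded y π ρ → Padded y π (y ∷ ρ)

padded-refl : ∀ {y} π → Padded y π π
padded-refl [] = nil
padded-refl (z ∷ π) = keep z (padded-refl π)

inserts-padded : ∀ {y} π {ρ} → ρ ∈ inserts y π → Padded y π ρ
inserts-padded [] (here refl) = pad nil
inserts-padded (z ∷ π) (here refl) = pad (padded-refl (z ∷ π))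
inserts-padded (z ∷ π) (there i) with ∈-map⁻ (z ∷_) i
... | ρ , j , refl = keep z (inserts-padded π j)

module _ {s : ℕ} {α : Assignment} {x : ℕ} where

  private
    a = valueOf α

    closure-path : ∀ {F} → Models a F → Path a F (closure s F)
    closure-path m = propagate-path _ m

  -- The state H of the shorter run stays ahead of the state F of the longer one.
  guessed-padded : ∀ {y π ρ F H} → Padded y π ρ → Models a F → Models a H → y ∉ vars H → Path a F (closure s H) →
    guessedRun s α π H x ≡ true → guessedRun s α ρ F x ≡ true
  guessed-padded {y} {F = F} {H} (pad e) mF mH y∉ p g
    with memNat y (vars (closure s F)) in yF
  ... | false = guessed-padded {F = closure s F} {H} e (models-path mF (closure-path mF)) mH y∉
                  (propagate-least _ mF (closure-closed s H) p) g
  ... | true with y ≡ᵇ x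
  ...   | true = refl
  ...   | false = guessed-padded {F = restrict (closure s F) (at a y)} {H} e (models-restrict {a} {closure s F} y (models-path mF (closure-path mF))) mH y∉
                    (path-absorb y (memNat⁻ (vars (closure s F)) yF) (y∉ ∘ path-vars (closure-path mH))
                      (propagate-least _ mF (closure-closed s H) p)) g
  guessed-padded {y} {F = F} {H} (keep z e) mF mH y∉ p g
    with memNat z (vars (closure s F)) in zF | memNat z (vars (closure s H)) in zH
  ... | false | false = guessed-padded {F = closure s F} {closure s H} e mF′ mH′ y∉′ (path-trans q (closure-path mH′)) g
    where
    mF′ = models-path mF (closure-path mF)
    mH′ = models-path mH (closure-path mH)
    y∉′ = y∉ ∘ path-vars (closure-path mH)
    q : Path a (closure s F) (closure s H)
    q = propagate-least _ mF (closure-closed s H) p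
  ... | false | true = contradiction
      (trans (sym (memNat⁺ {z} {vars (closure s F)} (path-vars (propagate-least _ mF (closure-closed s H) p) (memNat⁻ (vars (closure s H)) zH)))) zF) λ ()
  ... | true | zH′ with z ≡ᵇ x
  ...   | true = refl
  guessed-padded {y} {F = F} {H} (keep z e) mF mH y∉ p g | true | true | false =
    guessed-padded {F = restrict (closure s F) (at a z)} {restrict (closure s H) (at a z)} e (models-restrict {a} {closure s F} z mF′) mH″ (y∉′ ∘ proj₁ ∘ ∈-∖⁻ z (vars (closure s H)))
      (path-trans (path-restrict {a} z q) (closure-path {restrict (closure s H) (at a z)} mH″)) g
    where
    mF′ = models-path mF (closure-path mF)
    mH″ = models-restrict {a} {closure s H} z (models-path mH (closure-path mH))
    y∉′ = y∉ ∘ path-vars (closure-path mH)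
    q : Path a (closure s F) (closure s H)
    q = propagate-least _ mF (closure-closed s H) p
  guessed-padded {y} {F = F} {H} (keep z e) mF mH y∉ p g | true | false | false =
    guessed-padded {F = restrict (closure s F) (at a z)} {closure s H} e (models-restrict {a} {closure s F} z mF′) mH′ y∉′
      (path-trans (path-absorb z (memNat⁻ (vars (closure s F)) zF) z∉ q) (closure-path mH′)) g
    where
    mF′ = models-path mF (closure-path mF)
    mH′ = models-path mH (closure-path mH)
    y∉′ = y∉ ∘ path-vars (closure-path mH)
    q : Path a (closure s F) (closure s H)
    q = propagate-least _ mF (closure-closed s H) p
    z∉ : z ∉ vars (closure s H)
    z∉ i = contradiction (trans (sym (memNat⁺ i)) zH) λ ()

  guessed-restrict : ∀ {F y π ρ} → Models a F → ρ ∈ inserts y π →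
    guessedRun s α π (restrict F (at a y)) x ≡ true → guessedRun s α ρ F x ≡ true
  guessed-restrict {F} {y} {π} m i =
    guessed-padded (inserts-padded π i) m (models-restrict {a} {F} y m) (∉-∖ y (vars F))
      (step y (closure-path (models-restrict {a} {F} y m)))

guessed-local : ∀ {s α β x} π F → (∀ {y} → y ∈ vars F → valueOf α y ≡ valueOf β y) →
  guessedRun s α π F x ≡ guessedRun s β π F x
guessed-local [] F h = refl
guessed-local {s} {α} {β} {x} (y ∷ π) F h with memNat y (vars (closure s F)) in yF
... | false = guessed-local π (closure s F) (h ∘ propagate-vars _ F)
... | true with y ≡ᵇ x
...   | true = refl
...   | false = trans
        (cong (λ b → guessedRun s α π (restrict (closure s F) (lit y b)) x)
          (h {y} (propagate-vars _ F (memNat⁻ (vars (closure s F)) yF))))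
        (guessed-local π (restrict (closure s F) (lit y (valueOf β y)))
          (h ∘ propagate-vars _ F ∘ proj₁ ∘ ∈-∖⁻ y (vars (closure s F))))

-- Random permutations

expand-by-inverse : ∀ {M} r → r * M ≡ 1ℚ → ∀ p → p ≡ p * M * r
expand-by-inverse {M} r rM p =
  trans (sym (ℚ.*-identityʳ p)) (trans (cong (p *_) (trans (sym rM) (ℚ.*-comm r M))) (sym (ℚ.*-assoc p M r)))

*-cancelʳ : ∀ {p q M} r → r * M ≡ 1ℚ → p * M ≡ q * M → p ≡ q
*-cancelʳ {p} {q} r rM e =
  trans (expand-by-inverse r rM p) (trans (cong (_* r) e) (sym (expand-by-inverse r rM q)))

*-cancelʳ-≤ : ∀ {p q M} r → r * M ≡ 1ℚ → 0ℚ ≤ℚ r → p * M ≤ℚ q * M → p ≤ℚ q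
*-cancelʳ-≤ {p} {q} r rM 0≤r e =
  subst₂ _≤ℚ_ (sym (expand-by-inverse r rM p)) (sym (expand-by-inverse r rM q)) (*-monoʳ r 0≤r e)

∑-δ : ∀ {V x} (f : ℕ → ℚ) → Unique V → x ∈ V → ∑ V (λ y → when (y ≡ᵇ x) (f y)) ≡ f x
∑-δ {V} {x} f u i = trans (∑-↭ _ (↭-∖ u i)) (trans (cong₂ _+_ head tail) (ℚ.+-identityʳ (f x)))
  where
  head : when (x ≡ᵇ x) (f x) ≡ f x
  head rewrite ≡ᵇ-refl x = refl
  tail : ∑ (V ∖ x) (λ y → when (y ≡ᵇ x) (f y)) ≡ 0ℚ
  tail = trans (∑-cong (V ∖ x) (λ {y} j → cong (λ b → when b (f y)) (≢⇒≡ᵇ {y} {x} λ { refl → ∉-∖ x V j }))) (∑-0 (V ∖ x))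

∑-inserts-comm : ∀ (x y : ℕ) π (f : List ℕ → ℚ) →
  ∑ (inserts y π) (λ ρ → ∑ (inserts x ρ) f) ≡ ∑ (inserts x π) (λ ρ → ∑ (inserts y ρ) f)
∑-inserts-comm x y [] f =
  solve 2 (λ p q → (p :+ (q :+ con 0ℚ)) :+ con 0ℚ := (q :+ (p :+ con 0ℚ)) :+ con 0ℚ) refl (f (x ∷ y ∷ [])) (f (y ∷ x ∷ []))
  where open +-*-Solver
∑-inserts-comm x y (z ∷ π) f = begin
  ∑ (inserts y (z ∷ π)) (λ ρ → ∑ (inserts x ρ) f)
    ≡⟨ expand x y ⟩
  (f (x ∷ y ∷ z ∷ π) + (f (y ∷ x ∷ z ∷ π) + X x y)) + (X y x + Z x y)
    ≡⟨ cong (λ q → (f (x ∷ y ∷ z ∷ π) + (f (y ∷ x ∷ z ∷ π) + X x y)) + (X y x + q)) (∑-inserts-comm x y π (f ∘ (z ∷_))) ⟩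
  (f (x ∷ y ∷ z ∷ π) + (f (y ∷ x ∷ z ∷ π) + X x y)) + (X y x + Z y x)
    ≡⟨ solve 5 (λ p q a b c → (p :+ (q :+ a)) :+ (b :+ c) := (q :+ (p :+ b)) :+ (a :+ c)) refl
         (f (x ∷ y ∷ z ∷ π)) (f (y ∷ x ∷ z ∷ π)) (X x y) (X y x) (Z y x) ⟩
  (f (y ∷ x ∷ z ∷ π) + (f (x ∷ y ∷ z ∷ π) + X y x)) + (X x y + Z y x)
    ≡⟨ sym (expand y x) ⟩
  ∑ (inserts x (z ∷ π)) (λ ρ → ∑ (inserts y ρ) f) ∎
  where
  open ≡-Reasoning
  open +-*-Solver
  X Z : ℕ → ℕ → ℚ
  X x y = ∑ (inserts x π) (λ ρ → f (y ∷ z ∷ ρ))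
  Z x y = ∑ (inserts y π) (λ ρ → ∑ (inserts x ρ) (f ∘ (z ∷_)))
  expand : ∀ x y → ∑ (inserts y (z ∷ π)) (λ ρ → ∑ (inserts x ρ) f)
    ≡ (f (x ∷ y ∷ z ∷ π) + (f (y ∷ x ∷ z ∷ π) + X x y)) + (X y x + Z x y)
  expand x y = cong₂ _+_
    (cong (λ q → f (x ∷ y ∷ z ∷ π) + (f (y ∷ x ∷ z ∷ π) + q))
      (trans (∑-map (y ∷_) (map (z ∷_) (inserts x π)) f) (∑-map (z ∷_) (inserts x π) (f ∘ (y ∷_)))))
    (trans (∑-map (z ∷_) (inserts y π) (λ ρ → ∑ (inserts x ρ) f))
      (trans (∑-+ (inserts y π) (λ ρ → f (x ∷ z ∷ ρ)) (λ ρ → ∑ (map (z ∷_) (inserts x ρ)) f))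
        (cong (X y x +_) (∑-cong (inserts y π) (λ {ρ} _ → ∑-map (z ∷_) (inserts x ρ) f)))))

∑-perms-∷ : ∀ (x : ℕ) V (f : List ℕ → ℚ) → ∑ (perms (x ∷ V)) f ≡ ∑ (perms V) (λ π → ∑ (inserts x π) f)
∑-perms-∷ x V f = ∑-concatMap (inserts x) (perms V) f

∑-perms-↭ : ∀ {V W : List ℕ} (f : List ℕ → ℚ) → V ↭ W → ∑ (perms V) f ≡ ∑ (perms W) f
∑-perms-↭ f ↭-rfl = refl
∑-perms-↭ f (prep {V} {W} x p) = trans (∑-perms-∷ x V f) (trans (∑-perms-↭ _ p) (sym (∑-perms-∷ x W f)))
∑-perms-↭ f (swap {V} {W} x y p) =
  trans (trans (∑-perms-∷ x (y ∷ V) f) (∑-perms-∷ y V _))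
    (trans (trans (∑-perms-↭ _ p) (∑-cong (perms W) (λ {π} _ → ∑-inserts-comm x y π f)))
      (sym (trans (∑-perms-∷ y (x ∷ W) f) (∑-perms-∷ x W _))))
∑-perms-↭ f (↭-trn p q) = trans (∑-perms-↭ f p) (∑-perms-↭ f q)

∑-perms-first : ∀ {V} (f : List ℕ → ℚ) → Unique V → f [] ≡ 0ℚ →
  ∑ (perms V) f ≡ ∑ V (λ y → ∑ (perms (V ∖ y)) (f ∘ (y ∷_)))
∑-perms-first {[]} f u f[] = trans (ℚ.+-identityʳ (f [])) f[]
∑-perms-first {x ∷ V} f u@(_ ∷ u′) f[] = begin
  ∑ (perms (x ∷ V)) f
    ≡⟨ ∑-perms-∷ x V f ⟩
  ∑ (perms V) (λ π → ∑ (inserts x π) f)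
    ≡⟨ ∑-cong (perms V) (λ {π} _ → split π) ⟩
  ∑ (perms V) (λ π → f (x ∷ π) + later π)
    ≡⟨ ∑-+ (perms V) (f ∘ (x ∷_)) later ⟩
  ∑ (perms V) (f ∘ (x ∷_)) + ∑ (perms V) later
    ≡⟨ cong₂ _+_ (cong (λ W → ∑ (perms W) (f ∘ (x ∷_))) (sym (∖-head x∉)))
         (trans (∑-perms-first later u′ refl) (∑-cong V step′)) ⟩
  ∑ (x ∷ V) (λ y → ∑ (perms ((x ∷ V) ∖ y)) (f ∘ (y ∷_))) ∎
  where
  open ≡-Reasoning
  x∉ = Unique-∉ u
  later : List ℕ → ℚ
  later [] = 0ℚ
  later (z ∷ π) = ∑ (inserts x π) (f ∘ (z ∷_))
  split : ∀ π → ∑ (inserts x π) f ≡ f (x ∷ π) + later π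
  split [] = refl
  split (z ∷ π) = cong (f (x ∷ z ∷ π) +_) (∑-map (z ∷_) (inserts x π) f)
  step′ : ∀ {y} → y ∈ V → ∑ (perms (V ∖ y)) (later ∘ (y ∷_)) ≡ ∑ (perms ((x ∷ V) ∖ y)) (f ∘ (y ∷_))
  step′ {y} i = trans (sym (∑-perms-∷ x (V ∖ y) (f ∘ (y ∷_))))
    (cong (λ W → ∑ (perms W) (f ∘ (y ∷_))) (sym (∖-there {y} {x} V λ { refl → x∉ i })))

∑-inserts-1 : ∀ (x : ℕ) π → ∑ (inserts x π) (λ _ → 1ℚ) ≡ frac (suc (length π)) 1
∑-inserts-1 x π = trans (∑-1 (inserts x π)) (cong (λ n → frac n 1) (length-inserts π))
  where
  length-inserts : ∀ π → length (inserts x π) ≡ suc (length π)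
  length-inserts [] = refl
  length-inserts (z ∷ π) = cong suc (trans (List.length-map (z ∷_) (inserts x π)) (length-inserts π))

∈-inserts-length : ∀ {x : ℕ} π {ρ} → ρ ∈ inserts x π → length ρ ≡ suc (length π)
∈-inserts-length [] (here refl) = refl
∈-inserts-length (z ∷ π) (here refl) = refl
∈-inserts-length (z ∷ π) (there i) with ∈-map⁻ (z ∷_) i
... | ρ , j , refl = cong suc (∈-inserts-length π j)

∈-perms-length : ∀ V {π : List ℕ} → π ∈ perms V → length π ≡ length V
∈-perms-length [] (here refl) = refl
∈-perms-length (x ∷ V) i with find (∈-concatMap⁻ (inserts x) {xs = perms V} i)
... | π , j , k = trans (∈-inserts-length π k) (cong suc (∈-perms-length V j))

head-∈-inserts : ∀ (x : ℕ) π → (x ∷ π) ∈ inserts x π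
head-∈-inserts x [] = here refl
head-∈-inserts x (z ∷ π) = here refl

perms-nonempty : ∀ (V : List ℕ) → 0 < length (perms V)
perms-nonempty V = ∈-length (V∈ V)
  where
  V∈ : ∀ V → V ∈ perms V
  V∈ [] = here refl
  V∈ (x ∷ V) = ∈-concatMap⁺ (inserts x) (lose (V∈ V) (head-∈-inserts x V))

#perms : List ℕ → ℚ
#perms V = ∑ (perms V) (λ _ → 1ℚ)

#perms-∷ : ∀ x V → #perms (x ∷ V) ≡ frac (length (x ∷ V)) 1 * #perms V
#perms-∷ x V = trans (∑-perms-∷ x V _) (trans
  (∑-cong (perms V) (λ {π} i → trans (∑-inserts-1 x π) (cong (λ n → frac (suc n) 1) (∈-perms-length V i))))
  (trans (∑-const (perms V) _) (ℚ.*-comm (#perms V) _)))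

#perms-length : ∀ V W → length V ≡ length W → #perms V ≡ #perms W
#perms-length [] [] e = refl
#perms-length (x ∷ V) (y ∷ W) e = trans (#perms-∷ x V) (trans
  (cong₂ (λ n q → frac n 1 * q) e (#perms-length V W (ℕ.suc-injective e))) (sym (#perms-∷ y W)))

length-∖ : ∀ {y V} → Unique V → y ∈ V → length V ≡ suc (length (V ∖ y))
length-∖ u i = ↭-length (↭-∖ u i)

#perms-∖ : ∀ {y V} → Unique V → y ∈ V → #perms V ≡ frac (length V) 1 * #perms (V ∖ y)
#perms-∖ {y} {V} u i = trans (#perms-length V (y ∷ (V ∖ y)) (length-∖ u i))
  (trans (#perms-∷ y (V ∖ y)) (cong (λ n → frac n 1 * #perms (V ∖ y)) (sym (length-∖ u i))))

-- The probability of being guessed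

module _ (s : ℕ) where

  #guessed : CNF → ℕ → Assignment → ℚ
  #guessed F x α = ∑ (perms (vars F)) (λ π → when (guessedRun s α π F x) 1ℚ)

  pGuessed-∈ : ∀ {F x} α → x ∈ vars F → pGuessed s F x α * #perms (vars F) ≡ #guessed F x α
  pGuessed-∈ {F} {x} α i rewrite memNat⁺ i =
    frac-count (λ π → guessedRun s α π F x) (perms (vars F)) (perms-nonempty (vars F))

  pGuessed-∉ : ∀ {F x} α → x ∉ vars F → pGuessed s F x α ≡ 0ℚ
  pGuessed-∉ {F} α i rewrite ∉⇒memNat (vars F) i = refl

  pGuessed-nonNeg : ∀ F x α → 0ℚ ≤ℚ pGuessed s F x α
  pGuessed-nonNeg F x α with memNat x (vars F)
  ... | true = frac-nonNeg (count (λ π → guessedRun s α π F x) (perms (vars F))) (length (perms (vars F)))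
  ... | false = ℚ.≤-refl

  pGuessed-local : ∀ {F x} α β → (∀ {y} → y ∈ vars F → valueOf α y ≡ valueOf β y) → pGuessed s F x α ≡ pGuessed s F x β
  pGuessed-local {F} {x} α β h with x ∈? vars F
  ... | no x∉ = trans (pGuessed-∉ α x∉) (sym (pGuessed-∉ β x∉))
  ... | yes x∈ = *-cancelʳ {M = #perms (vars F)} (frac 1 (length (perms (vars F)))) (frac-1 (perms (vars F)) (perms-nonempty (vars F)))
    (trans (pGuessed-∈ α x∈) (trans
      (∑-cong (perms (vars F)) (λ {π} _ → cong (λ b → when b 1ℚ) (guessed-local {s} {α} {β} π F h)))
      (sym (pGuessed-∈ β x∈))))

  pGuessed-restrict : ∀ {F y} x α → Models (valueOf α) F → y ∈ vars F →
    pGuessed s (restrict F (at (valueOf α) y)) x α ≤ℚ pGuessed s F x α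
  pGuessed-restrict {F} {y} x α m y∈ with x ∈? (vars F ∖ y)
  ... | no x∉ = subst (_≤ℚ pGuessed s F x α) (sym (pGuessed-∉ α x∉)) (pGuessed-nonNeg F x α)
  ... | yes x∈ = *-cancelʳ-≤ {M = #perms (vars F)} (frac 1 (length (perms (vars F)))) (frac-1 (perms (vars F)) (perms-nonempty (vars F)))
    (frac-nonNeg 1 (length (perms (vars F)))) (begin
    q * #perms V
      ≡⟨ cong (q *_) (#perms-∖ u y∈) ⟩
    q * (n * #perms (V ∖ y))
      ≡⟨ solve 3 (λ q n k → q :* (n :* k) := n :* (q :* k)) refl q n (#perms (V ∖ y)) ⟩
    n * (q * #perms (V ∖ y))
      ≡⟨ cong (n *_) (pGuessed-∈ α x∈) ⟩
    n * #guessed (restrict F (at a y)) x α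
      ≡⟨ sym (∑-*ˡ (perms (V ∖ y)) n _) ⟩
    ∑ (perms (V ∖ y)) (λ π → n * when (guessedRun s α π (restrict F (at a y)) x) 1ℚ)
      ≡⟨ ∑-cong (perms (V ∖ y)) (λ {π} i → cong (_* when (guessedRun s α π (restrict F (at a y)) x) 1ℚ)
           (trans (cong (λ k → frac k 1) (trans (length-∖ u y∈) (cong suc (sym (∈-perms-length (V ∖ y) i)))))
             (sym (∑-inserts-1 y π)))) ⟩
    ∑ (perms (V ∖ y)) (λ π → ∑ (inserts y π) (λ _ → 1ℚ) * when (guessedRun s α π (restrict F (at a y)) x) 1ℚ)
      ≡⟨ ∑-cong (perms (V ∖ y)) (λ {π} _ → sym (∑-const (inserts y π) _)) ⟩
    ∑ (perms (V ∖ y)) (λ π → ∑ (inserts y π) (λ _ → when (guessedRun s α π (restrict F (at a y)) x) 1ℚ))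
      ≤⟨ ∑-mono (perms (V ∖ y)) (λ {π} _ → ∑-mono (inserts y π) (λ {ρ} i →
           when-mono (guessed-restrict {s} {α} {x} {F} m i))) ⟩
    ∑ (perms (V ∖ y)) (λ π → ∑ (inserts y π) (λ ρ → when (guessedRun s α ρ F x) 1ℚ))
      ≡⟨ sym (trans (∑-perms-↭ _ (↭-∖ u y∈)) (∑-perms-∷ y (V ∖ y) _)) ⟩
    #guessed F x α
      ≡⟨ sym (pGuessed-∈ α (proj₁ (∈-∖⁻ y V x∈))) ⟩
    pGuessed s F x α * #perms V ∎)
    where
    open ℚ.≤-Reasoning
    open +-*-Solver
    V = vars F
    u = proj₁ (proj₁ m)
    a = valueOf α
    n = frac (length V) 1
    q = pGuessed s (restrict F (at a y)) x α
    when-mono : ∀ {b c} → (b ≡ true → c ≡ true) → when b 1ℚ ≤ℚ when c 1ℚ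
    when-mono {true} h rewrite h refl = ℚ.≤-refl
    when-mono {false} {c} h = when-nonNeg c 0≤1

  pGuessed-first : ∀ {F x} α → Unique (vars F) → Closed s F → x ∈ vars F →
    frac (length (vars F)) 1 * pGuessed s F x α
      ≡ 1ℚ + ∑ (vars F) (λ y → pGuessed s (restrict F (at (valueOf α) y)) x α)
  pGuessed-first {F} {x} α u c x∈ =
    *-cancelʳ {M = M} (frac 1 (length (perms (V ∖ x)))) (frac-1 (perms (V ∖ x)) (perms-nonempty (V ∖ x))) (begin
    n * g F * M
      ≡⟨ solve 3 (λ n g M → n :* g :* M := g :* (n :* M)) refl n (g F) M ⟩
    g F * (n * M)
      ≡⟨ cong (g F *_) (sym (#perms-∖ u x∈)) ⟩
    g F * #perms V
      ≡⟨ pGuessed-∈ α x∈ ⟩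
    #guessed F x α
      ≡⟨ ∑-perms-first _ u refl ⟩
    ∑ V (λ y → ∑ (perms (V ∖ y)) (λ π → when (guessedRun s α (y ∷ π) F x) 1ℚ))
      ≡⟨ ∑-cong V (λ {y} y∈ → trans (first y y∈) (cong ((when (y ≡ᵇ x) 1ℚ + g (restrict F (at a y))) *_)
           (#perms-length (V ∖ y) (V ∖ x) (ℕ.suc-injective (trans (sym (length-∖ u y∈)) (length-∖ u x∈)))))) ⟩
    ∑ V (λ y → (when (y ≡ᵇ x) 1ℚ + g (restrict F (at a y))) * M)
      ≡⟨ ∑-*ʳ V M _ ⟩
    ∑ V (λ y → when (y ≡ᵇ x) 1ℚ + g (restrict F (at a y))) * M
      ≡⟨ cong (_* M) (trans (∑-+ V _ _) (cong (_+ ∑ V (λ y → g (restrict F (at a y)))) (∑-δ (λ _ → 1ℚ) u x∈))) ⟩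
    (1ℚ + ∑ V (λ y → g (restrict F (at a y)))) * M ∎)
    where
    open ≡-Reasoning
    open +-*-Solver
    V = vars F
    a = valueOf α
    n = frac (length V) 1
    M = #perms (V ∖ x)
    g : CNF → ℚ
    g G = pGuessed s G x α
    run-first : ∀ y π → y ∈ V → guessedRun s α (y ∷ π) F x ≡ (if y ≡ᵇ x then true else guessedRun s α π (restrict F (at a y)) x)
    run-first y π y∈ rewrite propagate-id (suc (length V)) {s} {F} c | memNat⁺ y∈ = refl
    first : ∀ y → y ∈ V → ∑ (perms (V ∖ y)) (λ π → when (guessedRun s α (y ∷ π) F x) 1ℚ)
      ≡ (when (y ≡ᵇ x) 1ℚ + g (restrict F (at a y))) * #perms (V ∖ y)
    first y y∈ with y ℕ.≟ x
    ... | yes refl = trans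
      (∑-cong (perms (V ∖ y)) (λ {π} _ → cong (λ b → when b 1ℚ) (trans (run-first y π y∈)
        (cong (λ b → if b then true else guessedRun s α π (restrict F (at a y)) y) (≡ᵇ-refl y)))))
      (trans (sym (ℚ.*-identityˡ (#perms (V ∖ y)))) (cong (_* #perms (V ∖ y)) (sym
        (cong₂ _+_ (cong (λ b → when b 1ℚ) (≡ᵇ-refl y)) (pGuessed-∉ {restrict F (at a y)} α (∉-∖ y V))))))
    ... | no y≢x = trans
      (∑-cong (perms (V ∖ y)) (λ {π} _ → cong (λ b → when b 1ℚ) (trans (run-first y π y∈)
        (cong (λ b → if b then true else guessedRun s α π (restrict F (at a y)) x) (≢⇒≡ᵇ {y} {x} y≢x)))))
      (trans (sym (pGuessed-∈ {restrict F (at a y)} α (∈-∖⁺ x∈ y≢x))) (cong (_* #perms (V ∖ y))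
        (trans (sym (ℚ.+-identityˡ (g (restrict F (at a y))))) (cong (λ b → when b 1ℚ + g (restrict F (at a y))) (sym (≢⇒≡ᵇ {y} {x} y≢x))))))

-- The distribution of AssignSatisfiableLiterals

forget : ℕ → Assignment → Assignment
forget y = filterᵇ (λ m → not (y ≡ᵇ var m))

memLit-forget : ∀ {y} m α → y ≢ var m → memLit m (forget y α) ≡ memLit m α
memLit-forget {y} m α y≢ = ≡-by-⇔
  (λ e → memLit⁺ {m} (proj₁ (∈-filterᵇ⁻ α (memLit⁻ {m} (forget y α) e))))
  (λ e → memLit⁺ {m} (∈-filterᵇ⁺ (memLit⁻ {m} α e) (cong not (≢⇒≡ᵇ y≢))))

memLit-allAssign-∉ : ∀ {V α l} → Unique V → α ∈ allAssign V → var l ∉ V → memLit l α ≡ false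
memLit-allAssign-∉ {V} {α} {l} u i l∉ with allAssign⁻ u i
... | a , refl = ¬true⇒false λ e → case ∈-map⁻ (at a) (memLit⁻ {l} (map (at a) V) e) of λ { (y , j , refl) → l∉ j }

∑-allAssign-∷ : ∀ x V f → ∑ (allAssign (x ∷ V)) f ≡ ∑ (allAssign V) (λ α → f (lit x true ∷ α) + f (lit x false ∷ α))
∑-allAssign-∷ x V f = trans (∑-concatMap _ (allAssign V) f)
  (∑-cong (allAssign V) (λ {α} _ → cong (f (lit x true ∷ α) +_) (ℚ.+-identityʳ (f (lit x false ∷ α)))))

when-+ : ∀ b p q → when b (p + q) ≡ when b p + when b q
when-+ true p q = refl
when-+ false p q = refl

when-* : ∀ b p q → when b (p * q) ≡ p * when b q
when-* true p q = refl
when-* false p q = sym (ℚ.*-zeroʳ p)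

forget-allAssign : ∀ {V α y} → Unique V → α ∈ allAssign V → y ∉ V → forget y α ≡ α
forget-allAssign {V} {α} {y} u i y∉ with allAssign⁻ u i
... | a , refl = List.filter-all (T? ∘ _) (All.tabulate λ {m} j → case ∈-map⁻ (at a) j of
  λ { (z , z∈ , refl) → ≡true⇒T (cong not (≢⇒≡ᵇ {y} {z} λ { refl → y∉ z∈ })) })

∑-allAssign-∖ : ∀ {V} l (f : Assignment → ℚ) → Unique V → var l ∈ V →
  ∑ (allAssign V) (λ α → when (memLit l α) (f (forget (var l) α))) ≡ ∑ (allAssign (V ∖ var l)) f
∑-allAssign-∖ {x ∷ V} l@(lit y b) f u@(_ ∷ u′) i with y ℕ.≟ x
∑-allAssign-∖ {x ∷ V} l@(lit x b) f u@(_ ∷ u′) i | yes refl = begin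
  ∑ (allAssign (x ∷ V)) (λ α → when (memLit l α) (f (forget x α)))
    ≡⟨ ∑-allAssign-∷ x V _ ⟩
  ∑ (allAssign V) (λ α → when (memLit l (lit x true ∷ α)) (f (forget x (lit x true ∷ α)))
                       + when (memLit l (lit x false ∷ α)) (f (forget x (lit x false ∷ α))))
    ≡⟨ ∑-cong (allAssign V) (λ {α} j → choose b (memLit-allAssign-∉ u′ j (Unique-∉ u)) (forget-allAssign u′ j (Unique-∉ u))) ⟩
  ∑ (allAssign V) f
    ≡⟨ cong (λ W → ∑ (allAssign W) f) (sym (∖-head (Unique-∉ u))) ⟩
  ∑ (allAssign ((x ∷ V) ∖ x)) f ∎
  where
  open ≡-Reasoning
  choose : ∀ b {α} → memLit (lit x b) α ≡ false → forget x α ≡ α →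
    when (memLit (lit x b) (lit x true ∷ α)) (f (forget x (lit x true ∷ α)))
      + when (memLit (lit x b) (lit x false ∷ α)) (f (forget x (lit x false ∷ α))) ≡ f α
  choose true {α} e e′ rewrite e | ≡ᵇ-refl x = trans (ℚ.+-identityʳ _) (cong f e′)
  choose false {α} e e′ rewrite e | ≡ᵇ-refl x = trans (ℚ.+-identityˡ _) (cong f e′)
∑-allAssign-∖ {x ∷ V} l@(lit y b) f u i | no y≢x with i
... | here y≡x = contradiction y≡x y≢x
... | there i′ = begin
  ∑ (allAssign (x ∷ V)) (λ α → when (memLit l α) (f (forget y α)))
    ≡⟨ ∑-allAssign-∷ x V _ ⟩
  ∑ (allAssign V) (λ α → when (memLit l (lit x true ∷ α)) (f (forget y (lit x true ∷ α)))
                       + when (memLit l (lit x false ∷ α)) (f (forget y (lit x false ∷ α))))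
    ≡⟨ ∑-cong (allAssign V) (λ {α} _ → trans (cong₂ _+_ (skip true α) (skip false α)) (sym (when-+ (memLit l α) _ _))) ⟩
  ∑ (allAssign V) (λ α → when (memLit l α) (g (forget y α)))
    ≡⟨ ∑-allAssign-∖ l g (tail u) i′ ⟩
  ∑ (allAssign (V ∖ y)) g
    ≡⟨ sym (∑-allAssign-∷ x (V ∖ y) f) ⟩
  ∑ (allAssign (x ∷ (V ∖ y))) f
    ≡⟨ cong (λ W → ∑ (allAssign W) f) (sym (∖-there V y≢x)) ⟩
  ∑ (allAssign ((x ∷ V) ∖ y)) f ∎
  where
  open ≡-Reasoning
  tail : Unique (x ∷ V) → Unique V
  tail (_ ∷ u) = u
  g : Assignment → ℚ
  g α = f (lit x true ∷ α) + f (lit x false ∷ α)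
  skip : ∀ c α → when (memLit l (lit x c ∷ α)) (f (forget y (lit x c ∷ α))) ≡ when (memLit l α) (f (lit x c ∷ forget y α))
  skip c α rewrite ≢⇒≡ᵇ {y} {x} y≢x = refl

∑-sat-restrict : ∀ {F} l (f : Assignment → ℚ) → WF F → var l ∈ vars F →
  ∑ (sat F) (λ α → when (memLit l α) (f (forget (var l) α))) ≡ ∑ (sat (restrict F l)) f
∑-sat-restrict {F} l f wf l∈ = begin
  ∑ (sat F) (λ α → when (memLit l α) (f (forget y α)))
    ≡⟨ ∑-filter _ (allAssign (vars F)) _ ⟩
  ∑ (allAssign (vars F)) (λ α → when (satAll α (clauses F)) (when (memLit l α) (f (forget y α))))
    ≡⟨ ∑-cong (allAssign (vars F)) (λ {α} i → toRestricted α i) ⟩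
  ∑ (allAssign (vars F)) (λ α → when (memLit l α) (h (forget y α)))
    ≡⟨ ∑-allAssign-∖ l h (proj₁ wf) l∈ ⟩
  ∑ (allAssign (vars F ∖ y)) h
    ≡⟨ sym (∑-filter _ (allAssign (vars F ∖ y)) f) ⟩
  ∑ (sat (restrict F l)) f ∎
  where
  open ≡-Reasoning
  y = var l
  G = restrict F l
  wfG = WF-restrict {F} l wf
  h : Assignment → ℚ
  h α = when (satAll α (clauses G)) (f α)
  toRestricted : ∀ α → α ∈ allAssign (vars F) →
    when (satAll α (clauses F)) (when (memLit l α) (f (forget y α))) ≡ when (memLit l α) (h (forget y α))
  toRestricted α i with memLit l α in lα
  ... | false = when-0 (satAll α (clauses F))
    where
    when-0 : ∀ b → when b 0ℚ ≡ 0ℚ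
    when-0 true = refl
    when-0 false = refl
  ... | true = cong (λ b → when b (f (forget y α))) (begin
    satAll α (clauses F)
      ≡⟨ satAll-ev α a (clauses F) (WF⇒Over {F} wf) ag ⟩
    ev a (clauses F)
      ≡⟨ sym (ev-↾ a l (trans (sym (ag l l∈)) lα) (clauses F)) ⟩
    ev a (clauses G)
      ≡⟨ sym (satAll-ev (forget y α) a (clauses G) (WF⇒Over {G} wfG) agG) ⟩
    satAll (forget y α) (clauses G) ∎)
    where
    a = valueOf α
    ag = allAssign-agree (proj₁ wf) i
    agG : Agree (vars G) (forget y α) a
    agG m m∈ with ∈-∖⁻ y (vars F) m∈
    ... | j , y≢ = trans (memLit-forget m α y≢) (ag m j)

#SL : CNF → ℚ
#SL F = ∑ (SL F) (λ _ → 1ℚ)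

SL-nonempty : ∀ {F a y} → Models a F → y ∈ vars F → 0 < length (SL F)
SL-nonempty {F} {a} {y} (wf , e) y∈ = ∈-length (SL⁺ wf a (at a y) (litV-at a y) e y∈)

SL⇒vars : ∀ F {l} → l ∈ SL F → var l ∈ vars F
SL⇒vars F i = ∈-literalsOver⁻ (vars F)
  (proj₁ (∈-filterᵇ⁻ {p = λ l → satisfiableᵇ (restrict F l)} (literalsOver (vars F)) i))

pAlg-local : ∀ n F {α β} → (∀ m → var m ∈ vars F → memLit m α ≡ memLit m β) → pAlg n F α ≡ pAlg n F β
pAlg-local n (cnf [] G) h = refl
pAlg-local zero (cnf (x ∷ V) G) h = refl
pAlg-local (suc n) F@(cnf (x ∷ V) G) h = ∑-cong (SL F) λ {l} i →
  cong₂ (λ b q → if b then frac 1 (length (SL F)) * q else 0ℚ)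
    (h l (SL⇒vars F i))
    (pAlg-local n (restrict F l) λ m m∈ → h m (proj₁ (∈-∖⁻ (var l) (vars F) m∈)))

pAlg-nonNeg : ∀ n F α → 0ℚ ≤ℚ pAlg n F α
pAlg-nonNeg n (cnf [] G) α = 0≤1
pAlg-nonNeg zero (cnf (x ∷ V) G) α = ℚ.≤-refl
pAlg-nonNeg (suc n) F@(cnf (x ∷ V) G) α = ∑-nonNeg (SL F) λ {l} _ →
  when-nonNeg (memLit l α) (*-nonNeg (frac-nonNeg 1 (length (SL F))) (pAlg-nonNeg n (restrict F l) α))

pASL-step : ∀ {F y} α → WF F → y ∈ vars F →
  pASL F α ≡ ∑ (SL F) (λ l → when (memLit l α) (frac 1 (length (SL F)) * pASL (restrict F l) α))
pASL-step {F@(cnf (x ∷ V) G)} α wf y∈ = ∑-cong (SL F) λ {l} i →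
  cong (λ n → when (memLit l α) (frac 1 (length (SL F)) * pAlg n (restrict F l) α))
    (ℕ.suc-injective (length-∖ (proj₁ wf) (proj₁ (SL⁻ wf i))))

∑-SL-agree : ∀ {F a α} (h : Literal → ℚ) → Models a F → Agree (vars F) α a →
  ∑ (SL F) (λ l → when (memLit l α) (h l)) ≡ ∑ (vars F) (h ∘ at a)
∑-SL-agree {F} {a} {α} h (wf , e) ag = trans (∑-SL wf _) (∑-cong (vars F) (λ {y} y∈ → chosen y y∈))
  where
  pick : ℕ → Bool → ℚ
  pick y b = when (satisfiableᵇ (restrict F (lit y b))) (when (memLit (lit y b) α) (h (lit y b)))
  sound : ∀ y b → y ∈ vars F → a y ≡ b → pick y b ≡ h (lit y b)
  sound y b y∈ ay
    rewrite satisfiableᵇ⁺ {restrict F (lit y b)} (restrict-satisfiable⁺ wf a (lit y b) (≡⇒≟ ay) e)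
          | trans (ag (lit y b) y∈) (≡⇒≟ ay) = refl
  reject : ∀ y b → y ∈ vars F → litV a (lit y b) ≡ false → pick y b ≡ 0ℚ
  reject y b y∈ ay rewrite trans (ag (lit y b) y∈) ay with satisfiableᵇ (restrict F (lit y b))
  ... | true = refl
  ... | false = refl
  chosen : ∀ y → y ∈ vars F → pick y true + pick y false ≡ h (at a y)
  chosen y y∈ with a y in ay
  ... | true = trans (cong₂ _+_ (sound y true y∈ ay) (reject y false y∈ (cong (λ b → ⌊ b B.≟ false ⌋) ay))) (ℚ.+-identityʳ _)
  ... | false = trans (cong₂ _+_ (reject y true y∈ (cong (λ b → ⌊ b B.≟ true ⌋) ay)) (sound y false y∈ ay)) (ℚ.+-identityˡ _)

pASL-vars : ∀ {F a} α → Models a F → Agree (vars F) α a →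
  pASL F α * #SL F ≡ ∑ (vars F) (λ y → pASL (restrict F (at a y)) α)
pASL-vars {cnf [] G} α m ag = refl
pASL-vars {F@(cnf (x ∷ V) G)} {a} α m@(wf , _) ag = begin
  pASL F α * #SL F
    ≡⟨ cong (_* #SL F) (trans (pASL-step α wf (here refl)) (∑-SL-agree {F} {a} {α} (λ l → r * pASL (restrict F l) α) m ag)) ⟩
  ∑ (vars F) (λ y → r * pASL (restrict F (at a y)) α) * #SL F
    ≡⟨ cong (_* #SL F) (∑-*ˡ (vars F) r _) ⟩
  r * Σp * #SL F
    ≡⟨ solve 3 (λ r s n → r :* s :* n := (r :* n) :* s) refl r Σp (#SL F) ⟩
  r * #SL F * Σp
    ≡⟨ cong (_* Σp) (frac-1 (SL F) (SL-nonempty {F} {a} m (here refl))) ⟩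
  1ℚ * Σp
    ≡⟨ ℚ.*-identityˡ Σp ⟩
  Σp ∎
  where
  open ≡-Reasoning
  open +-*-Solver
  r = frac 1 (length (SL F))
  Σp = ∑ (vars F) (λ y → pASL (restrict F (at a y)) α)

χSL : CNF → ℕ → Bool → ℚ
χSL F z b = when (satisfiableᵇ (restrict F (lit z b))) 1ℚ

χSL-nonNeg : ∀ F z b → 0ℚ ≤ℚ χSL F z b
χSL-nonNeg F z b = when-nonNeg (satisfiableᵇ (restrict F (lit z b))) 0≤1

χSL-1 : ∀ {F a} y → Models a F → χSL F y (a y) ≡ 1ℚ
χSL-1 {F} {a} y (wf , e) = cong (λ t → when t 1ℚ)
  (satisfiableᵇ⁺ {restrict F (at a y)} (restrict-satisfiable⁺ wf a (at a y) (litV-at a y) e))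

χSL-restrict : ∀ {F} l z b → WF F → var l ≢ z → χSL (restrict F l) z b ≤ℚ χSL F z b
χSL-restrict {F} l z b wf l≢z = case-on (satisfiableᵇ (restrict (restrict F l) (lit z b))) refl
  where
  sat⇒ : satisfiableᵇ (restrict (restrict F l) (lit z b)) ≡ true → Satisfiable (restrict F (lit z b))
  sat⇒ e = satisfiable⁺ (WF-restrict {F} (lit z b) wf) (proj₁ model) (proj₂ (proj₂ model))
    where
    model : ∃ λ c → litV c l ≡ true × ev c (clauses (restrict F (lit z b))) ≡ true
    model = restrict-satisfiable⁻ {restrict F (lit z b)} (WF-restrict {F} (lit z b) wf) {l}
      (subst Satisfiable (restrict-comm {l} {lit z b} l≢z F) (satisfiableᵇ⁻ (restrict (restrict F l) (lit z b)) e))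
  case-on : ∀ t → satisfiableᵇ (restrict (restrict F l) (lit z b)) ≡ t → when t 1ℚ ≤ℚ χSL F z b
  case-on false _ = χSL-nonNeg F z b
  case-on true e = ℚ.≤-reflexive (sym (cong (λ t → when t 1ℚ) (satisfiableᵇ⁺ {restrict F (lit z b)} (sat⇒ e))))

weight : CNF → ℕ → ℚ
weight F z = χSL F z true + χSL F z false

#SL-weight : ∀ {F} → WF F → #SL F ≡ ∑ (vars F) (weight F)
#SL-weight wf = ∑-SL wf (λ _ → 1ℚ)

weight-≥1 : ∀ {F a} y → Models a F → 1ℚ ≤ℚ weight F y
weight-≥1 {F} {a} y m = forced (a y) (χSL-1 {F} {a} y m)
  where
  forced : ∀ b → χSL F y b ≡ 1ℚ → 1ℚ ≤ℚ weight F y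
  forced true e = ℚ.+-mono-≤ (ℚ.≤-reflexive (sym e)) (χSL-nonNeg F y false)
  forced false e = ℚ.+-mono-≤ (χSL-nonNeg F y true) (ℚ.≤-reflexive (sym e))

#SL-restrict : ∀ {F a y} → Models a F → y ∈ vars F → 1ℚ + #SL (restrict F (at a y)) ≤ℚ #SL F
#SL-restrict {F} {a} {y} m@(wf , e) y∈ = subst₂ _≤ℚ_
  (cong (1ℚ +_) (sym (#SL-weight (WF-restrict {F} (at a y) wf))))
  (trans (sym (∑-↭ (weight F) (↭-∖ (proj₁ wf) y∈))) (sym (#SL-weight wf)))
  (ℚ.+-mono-≤ (weight-≥1 {F} {a} y m) (∑-mono (vars F ∖ y) {weight (restrict F (at a y))} {weight F} inherit))
  where
  inherit : ∀ {z} → z ∈ vars F ∖ y → weight (restrict F (at a y)) z ≤ℚ weight F z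
  inherit {z} i = ℚ.+-mono-≤ (χSL-restrict (at a y) z true wf y≢z) (χSL-restrict (at a y) z false wf y≢z)
    where y≢z = proj₂ (∈-∖⁻ y (vars F) i)

-- Committing early to one literal of α can only help: #SL drops by at least one.
pASL-restrict : ∀ n {F a y} α → length (vars F) ≡ n → Models a F → Agree (vars F) α a → y ∈ vars F →
  pASL F α ≤ℚ pASL (restrict F (at a y)) α
pASL-restrict zero {F} α len m ag y∈ with vars F
pASL-restrict zero {F} α () m ag (here _) | _ ∷ _
pASL-restrict (suc n) {F} {a} {y} α len m@(wf , e) ag y∈ =
  *-cancelʳ-≤ {M = #SL F} (frac 1 (length (SL F))) (frac-1 (SL F) (SL-nonempty {F} {a} m y∈)) (frac-nonNeg 1 (length (SL F))) (begin
  pASL F α * #SL F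
    ≡⟨ pASL-vars α m ag ⟩
  ∑ (vars F) (λ z → pASL (F ⟨ z ⟩) α)
    ≡⟨ ∑-↭ _ (↭-∖ u y∈) ⟩
  p + ∑ (vars F ∖ y) (λ z → pASL (F ⟨ z ⟩) α)
    ≤⟨ ℚ.+-monoʳ-≤ p (∑-mono (vars F ∖ y) ih) ⟩
  p + ∑ (vars F ∖ y) (λ z → pASL (F ⟨ y ⟩ ⟨ z ⟩) α)
    ≡⟨ cong (p +_) (sym (pASL-vars α (models-restrict {a} {F} y m) λ k k∈ → ag k (proj₁ (∈-∖⁻ y (vars F) k∈)))) ⟩
  p + p * #SL (F ⟨ y ⟩)
    ≡⟨ solve 2 (λ p k → p :+ p :* k := p :* (con 1ℚ :+ k)) refl p (#SL (F ⟨ y ⟩)) ⟩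
  p * (1ℚ + #SL (F ⟨ y ⟩))
    ≤⟨ *-monoˡ p (pAlg-nonNeg (length (vars (F ⟨ y ⟩))) (F ⟨ y ⟩) α) (#SL-restrict {F} {a} m y∈) ⟩
  p * #SL F ∎)
  where
  open ℚ.≤-Reasoning
  open +-*-Solver
  _⟨_⟩ : CNF → ℕ → CNF
  G ⟨ z ⟩ = restrict G (at a z)
  u = proj₁ wf
  p = pASL (F ⟨ y ⟩) α
  ih : ∀ {z} → z ∈ vars F ∖ y → pASL (F ⟨ z ⟩) α ≤ℚ pASL (F ⟨ y ⟩ ⟨ z ⟩) α
  ih {z} i with ∈-∖⁻ y (vars F) i
  ... | z∈ , y≢z = subst (λ G → pASL (F ⟨ z ⟩) α ≤ℚ pASL G α)
    (restrict-comm {at a z} {at a y} (λ e → y≢z (sym e)) F)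
    (pASL-restrict n α (ℕ.suc-injective (trans (sym (length-∖ u z∈)) len)) (models-restrict {a} {F} z m)
      (λ k k∈ → ag k (proj₁ (∈-∖⁻ z (vars F) k∈))) (∈-∖⁺ y∈ (y≢z ∘ sym)))

pASL-forget : ∀ {F} l α → pASL (restrict F l) (forget (var l) α) ≡ pASL (restrict F l) α
pASL-forget {F} l α = pAlg-local (length (vars (restrict F l))) (restrict F l)
  λ m m∈ → memLit-forget m α (proj₂ (∈-∖⁻ (var l) (vars F) m∈))

∑-pASL : ∀ n {F} → length (vars F) ≡ n → WF F → Satisfiable F → ∑ (sat F) (pASL F) ≡ 1ℚ
∑-pASL zero {cnf [] G} len wf h with satAll [] G
... | true = refl
∑-pASL (suc n) {F@(cnf (x ∷ V) G)} len wf h = begin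
  ∑ (sat F) (pASL F)
    ≡⟨ ∑-cong (sat F) (λ {α} _ → pASL-step α wf (here refl)) ⟩
  ∑ (sat F) (λ α → ∑ (SL F) (λ l → when (memLit l α) (r * pASL (restrict F l) α)))
    ≡⟨ ∑-swap (sat F) (SL F) _ ⟩
  ∑ (SL F) (λ l → ∑ (sat F) (λ α → when (memLit l α) (r * pASL (restrict F l) α)))
    ≡⟨ ∑-cong (SL F) (λ {l} i → begin
         ∑ (sat F) (λ α → when (memLit l α) (r * pASL (restrict F l) α))
           ≡⟨ ∑-cong (sat F) (λ {α} _ → trans (when-* (memLit l α) r _)
                (cong (λ q → r * when (memLit l α) q) (sym (pASL-forget {F} l α)))) ⟩
         ∑ (sat F) (λ α → r * when (memLit l α) (pASL (restrict F l) (forget (var l) α)))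
           ≡⟨ ∑-*ˡ (sat F) r _ ⟩
         r * ∑ (sat F) (λ α → when (memLit l α) (pASL (restrict F l) (forget (var l) α)))
           ≡⟨ cong (r *_) (trans (∑-sat-restrict l (pASL (restrict F l)) wf (proj₁ (SL⁻ wf i)))
                (∑-pASL n (ℕ.suc-injective (trans (sym (length-∖ (proj₁ wf) (proj₁ (SL⁻ wf i)))) len))
                  (WF-restrict {F} l wf) (proj₂ (SL⁻ wf i)))) ⟩
         r * 1ℚ ∎) ⟩
  ∑ (SL F) (λ _ → r * 1ℚ)
    ≡⟨ ∑-*ˡ (SL F) r (λ _ → 1ℚ) ⟩
  r * #SL F
    ≡⟨ (case satisfiable⁻ wf h of λ (a , e) → frac-1 (SL F) (SL-nonempty {F} {a} (wf , e) (here refl))) ⟩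
  1ℚ ∎
  where
  open ≡-Reasoning
  r = frac 1 (length (SL F))

-- Costs

0≤q-p : ∀ {p q} → p ≤ℚ q → 0ℚ ≤ℚ q - p
0≤q-p {p} {q} h = subst (_≤ℚ q - p) (ℚ.+-inverseʳ p) (ℚ.+-monoˡ-≤ (ℚ.- p) h)

+-cancelʳ-≤ : ∀ {p q} r → p + r ≤ℚ q + r → p ≤ℚ q
+-cancelʳ-≤ {p} {q} r h = subst₂ _≤ℚ_ (cancel p) (cancel q) (ℚ.+-monoˡ-≤ (ℚ.- r) h)
  where
  open +-*-Solver
  cancel : ∀ p → p + r - r ≡ p
  cancel p = solve 2 (λ p r → p :+ r :- r := p) refl p r

-- Chebyshev's correlation inequality: 0 ≤ (P − p)(g − G), summed over V.
correlation : ∀ {A : Set} (V : List A) (P G : A → ℚ) {N p g} →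
  (∀ {y} → y ∈ V → p ≤ℚ P y) → (∀ {y} → y ∈ V → G y ≤ℚ g) →
  p * N ≡ ∑ V P → frac (length V) 1 * g ≡ 1ℚ + ∑ V G →
  ∑ V (λ y → P y * G y) + p ≤ℚ N * (p * g)
correlation V P G {N} {p} {g} p≤P G≤g ΣP ΣG = +-cancelʳ-≤ (p * ∑ V G) (begin
  ∑ V (λ y → P y * G y) + p + p * ∑ V G
    ≡⟨ solve 3 (λ s p t → s :+ p :+ p :* t := s :+ (con 1ℚ :+ t) :* p) refl (∑ V (λ y → P y * G y)) p (∑ V G) ⟩
  ∑ V (λ y → P y * G y) + (1ℚ + ∑ V G) * p
    ≡⟨ cong (λ q → ∑ V (λ y → P y * G y) + q) (trans (cong (_* p) (sym ΣG))
         (solve 3 (λ n g p → n :* g :* p := n :* (p :* g)) refl (frac (length V) 1) g p)) ⟩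
  ∑ V (λ y → P y * G y) + frac (length V) 1 * (p * g)
    ≡⟨ cong (∑ V (λ y → P y * G y) +_) (sym (trans (∑-const V (p * g)) (cong (_* (p * g)) (∑-1 V)))) ⟩
  ∑ V (λ y → P y * G y) + ∑ V (λ _ → p * g)
    ≡⟨ sym (∑-+ V _ _) ⟩
  ∑ V (λ y → P y * G y + p * g)
    ≤⟨ ∑-mono V (λ {y} i → rearrange (P y) (G y) (p≤P i) (G≤g i)) ⟩
  ∑ V (λ y → P y * g + p * G y)
    ≡⟨ trans (∑-+ V _ _) (cong₂ _+_ (∑-*ʳ V g P) (∑-*ˡ V p G)) ⟩
  ∑ V P * g + p * ∑ V G
    ≡⟨ cong (_+ p * ∑ V G) (trans (cong (_* g) (sym ΣP)) (solve 3 (λ p N g → p :* N :* g := N :* (p :* g)) refl p N g)) ⟩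
  N * (p * g) + p * ∑ V G ∎)
  where
  open ℚ.≤-Reasoning
  open +-*-Solver
  rearrange : ∀ P G → p ≤ℚ P → G ≤ℚ g → P * G + p * g ≤ℚ P * g + p * G
  rearrange P G h h′ = subst₂ _≤ℚ_ (ℚ.+-identityʳ (P * G + p * g))
    (solve 4 (λ P G p g → P :* G :+ p :* g :+ (P :- p) :* (g :- G) := P :* g :+ p :* G) refl P G p g)
    (ℚ.+-monoʳ-≤ (P * G + p * g) (*-nonNeg (0≤q-p h) (0≤q-p h′)))

module _ (S : ℚ) (s : ℕ) where

  cost-∉ : ∀ {F x} → x ∉ vars F → cost S s F x ≡ 0ℚ
  cost-∉ {F} x∉ rewrite ∉⇒memNat (vars F) x∉ = refl

  cost-nonFrozen : ∀ {F x} → x ∈ vars F → frozenB F x ≡ false → cost S s F x ≡ S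
  cost-nonFrozen {F} x∈ fr rewrite memNat⁺ x∈ | fr = refl

  meanGuessed : CNF → ℕ → ℚ
  meanGuessed F x = ∑ (sat F) (λ α → pASL F α * pGuessed s F x α)

  cost-frozen : ∀ {F x} → x ∈ vars F → frozenB F x ≡ true → cost S s F x ≡ meanGuessed F x
  cost-frozen {F} x∈ fr rewrite memNat⁺ x∈ | fr = refl

  cost-≤ : ∀ {k F} x → AdmissibleS k s S → WF F → LeK k F → Satisfiable F → cost S s F x ≤ℚ S
  cost-≤ {k} {F} x (S≥ , bound) wf le h with x ∈? vars F
  ... | no x∉ = subst (_≤ℚ S) (sym (cost-∉ {F} x∉)) (S≥ 0)
  ... | yes x∈ = by-frozen (frozenB F x) refl
    where
    by-frozen : ∀ b → frozenB F x ≡ b → cost S s F x ≤ℚ S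
    by-frozen false fr = ℚ.≤-reflexive (cost-nonFrozen {F} x∈ fr)
    by-frozen true fr = begin
      cost S s F x
        ≡⟨ cost-frozen {F} x∈ fr ⟩
      ∑ (sat F) (λ α → pASL F α * pGuessed s F x α)
        ≤⟨ ∑-mono (sat F) (λ {α} i → *-monoˡ (pASL F α) (pAlg-nonNeg (length (vars F)) F α) (bound F wf le h x x∈ fr α i)) ⟩
      ∑ (sat F) (λ α → pASL F α * S)
        ≡⟨ trans (∑-*ʳ (sat F) S (pASL F)) (cong (_* S) (∑-pASL (length (vars F)) refl wf h)) ⟩
      1ℚ * S
        ≡⟨ ℚ.*-identityˡ S ⟩
      S ∎
      where open ℚ.≤-Reasoning

  cost-restrict-frozen : ∀ {F x} l → WF F → x ∈ vars F → frozenB F x ≡ true → l ∈ SL F →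
    cost S s (restrict F l) x
      ≡ ∑ (sat F) (λ α → when (memLit l α) (pASL (restrict F l) α * pGuessed s (restrict F l) x α))
  cost-restrict-frozen {F} {x} l wf x∈ fr i = begin
    cost S s G x
      ≡⟨ as-mean ⟩
    ∑ (sat G) (λ α → pASL G α * pGuessed s G x α)
      ≡⟨ sym (∑-sat-restrict l _ wf (proj₁ (SL⁻ wf i))) ⟩
    ∑ (sat F) (λ α → when (memLit l α) (pASL G (forget (var l) α) * pGuessed s G x (forget (var l) α)))
      ≡⟨ ∑-cong (sat F) (λ {α} _ → cong (when (memLit l α)) (cong₂ _*_ (pASL-forget {F} l α)
           (pGuessed-local s {G} (forget (var l) α) α λ {y} y∈ →
             memLit-forget (lit y true) α (proj₂ (∈-∖⁻ (var l) (vars F) y∈))))) ⟩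
    ∑ (sat F) (λ α → when (memLit l α) (pASL G α * pGuessed s G x α)) ∎
    where
    open ≡-Reasoning
    G = restrict F l
    as-mean : cost S s G x ≡ meanGuessed G x
    as-mean with x ∈? (vars F ∖ var l)
    ... | yes x∈′ = cost-frozen {G} x∈′ (frozen-restrict l wf (proj₂ (SL⁻ wf i)) x∈′ fr)
    ... | no x∉ = trans (cost-∉ {G} x∉) (sym (trans
      (∑-cong (sat G) (λ {α} _ → trans (cong (pASL G α *_) (pGuessed-∉ s {G} α x∉)) (ℚ.*-zeroʳ (pASL G α))))
      (∑-0 (sat G))))

  frozen-decrease : ∀ {F x} → WF F → Satisfiable F → Closed s F → x ∈ vars F → frozenB F x ≡ true →
    ∑ (SL F) (λ l → cost S s (restrict F l) x) + 1ℚ ≤ℚ #SL F * cost S s F x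
  frozen-decrease {F} {x} wf h c x∈ fr = begin
    ∑ (SL F) (λ l → cost S s (restrict F l) x) + 1ℚ
      ≡⟨ cong₂ _+_ (∑-cong (SL F) (λ {l} i → cost-restrict-frozen {F} {x} l wf x∈ fr i))
           (sym (∑-pASL (length (vars F)) refl wf h)) ⟩
    ∑ (SL F) (λ l → ∑ (sat F) (λ α → when (memLit l α) (term l α))) + ∑ (sat F) (pASL F)
      ≡⟨ cong (_+ ∑ (sat F) (pASL F)) (∑-swap (SL F) (sat F) _) ⟩
    ∑ (sat F) (λ α → ∑ (SL F) (λ l → when (memLit l α) (term l α))) + ∑ (sat F) (pASL F)
      ≡⟨ sym (∑-+ (sat F) _ _) ⟩
    ∑ (sat F) (λ α → ∑ (SL F) (λ l → when (memLit l α) (term l α)) + pASL F α)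
      ≤⟨ ∑-mono (sat F) (λ {α} → pointwise α) ⟩
    ∑ (sat F) (λ α → #SL F * (pASL F α * pGuessed s F x α))
      ≡⟨ ∑-*ˡ (sat F) (#SL F) _ ⟩
    #SL F * meanGuessed F x
      ≡⟨ cong (#SL F *_) (sym (cost-frozen {F} x∈ fr)) ⟩
    #SL F * cost S s F x ∎
    where
    open ℚ.≤-Reasoning
    term : Literal → Assignment → ℚ
    term l α = pASL (restrict F l) α * pGuessed s (restrict F l) x α
    pointwise : ∀ α → α ∈ sat F →
      ∑ (SL F) (λ l → when (memLit l α) (term l α)) + pASL F α ≤ℚ #SL F * (pASL F α * pGuessed s F x α)
    pointwise α i = subst (λ q → q + pASL F α ≤ℚ #SL F * (pASL F α * pGuessed s F x α))
      (sym (∑-SL-agree {F} {a} {α} (λ l → term l α) m ag))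
      (correlation (vars F) (λ y → pASL (restrict F (at a y)) α) (λ y → pGuessed s (restrict F (at a y)) x α)
        (pASL-restrict (length (vars F)) {F} {a} α refl m ag)
        (pGuessed-restrict s x α m)
        (pASL-vars α m ag)
        (pGuessed-first s α (proj₁ wf) c x∈))
      where
      a = valueOf α
      ag = sat⇒agree wf i
      m : Models a F
      m = wf , sat⇒ev wf i

  nonFrozen-decrease : ∀ {k F x} → AdmissibleS k s S → WF F → LeK k F → x ∈ vars F → frozenB F x ≡ false →
    ∑ (SL F) (λ l → cost S s (restrict F l) x) + (S + S) ≤ℚ #SL F * cost S s F x
  nonFrozen-decrease {k} {F} {x} adm wf le x∈ fr = begin
    ∑ (SL F) (λ l → cost S s (restrict F l) x) + (S + S)
      ≡⟨ cong (∑ (SL F) (λ l → cost S s (restrict F l) x) +_) (sym on-x) ⟩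
    ∑ (SL F) (λ l → cost S s (restrict F l) x) + ∑ (SL F) (λ l → when (var l ≡ᵇ x) S)
      ≡⟨ sym (∑-+ (SL F) _ _) ⟩
    ∑ (SL F) (λ l → cost S s (restrict F l) x + when (var l ≡ᵇ x) S)
      ≤⟨ ∑-mono (SL F) (λ {l} → pointwise l) ⟩
    ∑ (SL F) (λ _ → S)
      ≡⟨ ∑-const (SL F) S ⟩
    #SL F * S
      ≡⟨ cong (#SL F *_) (sym (cost-nonFrozen {F} x∈ fr)) ⟩
    #SL F * cost S s F x ∎
    where
    open ℚ.≤-Reasoning
    pointwise : ∀ l → l ∈ SL F → cost S s (restrict F l) x + when (var l ≡ᵇ x) S ≤ℚ S
    pointwise l i with var l ℕ.≟ x
    ... | yes refl = ℚ.≤-reflexive (trans (cong₂ _+_ (cost-∉ {restrict F l} (∉-∖ (var l) (vars F)))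
                       (cong (λ b → when b S) (≡ᵇ-refl (var l)))) (ℚ.+-identityˡ S))
    ... | no l≢x = ℚ.≤-trans (ℚ.≤-reflexive (trans (cong (λ b → cost S s (restrict F l) x + when b S) (≢⇒≡ᵇ {var l} {x} l≢x))
                       (ℚ.+-identityʳ _)))
        (cost-≤ {k} {restrict F l} x adm (WF-restrict {F} l wf) (LeK-restrict {k} {F} l le) (proj₂ (SL⁻ wf i)))
    when-comm : ∀ b c {q} → when b (when c q) ≡ when c (when b q)
    when-comm true true = refl
    when-comm true false = refl
    when-comm false true = refl
    when-comm false false = refl
    χ : ℕ → Bool → ℚ
    χ y b = when (satisfiableᵇ (restrict F (lit y b))) S
    nf = nonFrozen⁻ wf x∈ fr
    χ-x : ∀ b a → ev a (clauses F) ≡ true → a x ≡ b → χ x b ≡ S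
    χ-x b a e ax = cong (λ t → when t S)
      (satisfiableᵇ⁺ {restrict F (lit x b)} (restrict-satisfiable⁺ wf a (lit x b) (≡⇒≟ ax) e))
    on-x : ∑ (SL F) (λ l → when (var l ≡ᵇ x) S) ≡ S + S
    on-x = trans (∑-SL wf _) (trans
      (∑-cong (vars F) (λ {y} _ → trans
        (cong₂ _+_ (when-comm (satisfiableᵇ (restrict F (lit y true))) (y ≡ᵇ x))
                   (when-comm (satisfiableᵇ (restrict F (lit y false))) (y ≡ᵇ x)))
        (sym (when-+ (y ≡ᵇ x) (χ y true) (χ y false)))))
      (trans (∑-δ (λ y → χ y true + χ y false) (proj₁ wf) x∈) (both nf)))
      where
      both : NonFrozen wf x → χ x true + χ x false ≡ S + S
      both (a , b , (ea , ax) , (eb , bx)) = cong₂ _+_ (χ-x true a ea ax) (χ-x false b eb bx)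

  costF-restrict : ∀ F l → costF S s (restrict F l) ≡ ∑ (vars F) (cost S s (restrict F l))
  costF-restrict F l = trans (∑-filter _ (vars F) (cost S s (restrict F l))) (∑-cong (vars F) λ {z} _ → same z)
    where
    same : ∀ z → when (not (var l ≡ᵇ z)) (cost S s (restrict F l) z) ≡ cost S s (restrict F l) z
    same z with var l ℕ.≟ z
    ... | yes refl = trans (cong (λ b → when (not b) (cost S s (restrict F l) z)) (≡ᵇ-refl z))
                           (sym (cost-∉ {restrict F l} (∉-∖ z (vars F))))
    ... | no l≢z = cong (λ b → when (not b) (cost S s (restrict F l) z)) (≢⇒≡ᵇ {var l} {z} l≢z)

  total-decrease : ∀ {k F} → AdmissibleS k s S → WF F → LeK k F → Satisfiable F → Closed s F →
    ∑ (SL F) (λ l → costF S s (restrict F l)) + (frac (nN F) 1 * (S + S) + frac (nC F) 1) ≤ℚ #SL F * costF S s F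
  total-decrease {k} {F} adm wf le h c = begin
    ∑ (SL F) (λ l → costF S s (restrict F l)) + (frac (nN F) 1 * (S + S) + frac (nC F) 1)
      ≡⟨ cong₂ _+_
           (trans (∑-cong (SL F) (λ {l} _ → costF-restrict F l)) (∑-swap (SL F) (vars F) _))
           (cong₂ _+_
             (trans (cong (_* (S + S)) (sym (∑-count (not ∘ frozenB F) (vars F)))) (sym (∑-*ʳ (vars F) (S + S) _)))
             (sym (∑-count (frozenB F) (vars F)))) ⟩
    ∑ (vars F) after + (∑ (vars F) (λ x → when (not (frozenB F x)) 1ℚ * (S + S)) + ∑ (vars F) (λ x → when (frozenB F x) 1ℚ))
      ≡⟨ sym (trans (∑-+ (vars F) _ _) (cong (∑ (vars F) after +_) (∑-+ (vars F) _ _))) ⟩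
    ∑ (vars F) (λ x → after x + drop x)
      ≤⟨ ∑-mono (vars F) (λ {x} x∈ → by-frozen x x∈ (frozenB F x) refl) ⟩
    ∑ (vars F) (λ x → #SL F * cost S s F x)
      ≡⟨ ∑-*ˡ (vars F) (#SL F) (cost S s F) ⟩
    #SL F * costF S s F ∎
    where
    open ℚ.≤-Reasoning
    after drop : ℕ → ℚ
    after x = ∑ (SL F) (λ l → cost S s (restrict F l) x)
    drop x = when (not (frozenB F x)) 1ℚ * (S + S) + when (frozenB F x) 1ℚ
    drop-frozen : when false 1ℚ * (S + S) + when true 1ℚ ≡ 1ℚ
    drop-frozen = trans (cong (_+ 1ℚ) (ℚ.*-zeroˡ (S + S))) (ℚ.+-identityˡ 1ℚ)
    drop-nonFrozen : when true 1ℚ * (S + S) + when false 1ℚ ≡ S + S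
    drop-nonFrozen = trans (ℚ.+-identityʳ _) (ℚ.*-identityˡ (S + S))
    by-frozen : ∀ x → x ∈ vars F → ∀ b → frozenB F x ≡ b → after x + drop x ≤ℚ #SL F * cost S s F x
    by-frozen x x∈ true fr = subst (λ q → after x + q ≤ℚ #SL F * cost S s F x)
      (sym (trans (cong (λ b → when (not b) 1ℚ * (S + S) + when b 1ℚ) fr) drop-frozen))
      (frozen-decrease {F} {x} wf h c x∈ fr)
    by-frozen x x∈ false fr = subst (λ q → after x + q ≤ℚ #SL F * cost S s F x)
      (sym (trans (cong (λ b → when (not b) 1ℚ * (S + S) + when b 1ℚ) fr) drop-nonFrozen))
      (nonFrozen-decrease {k} {F} {x} adm wf le x∈ fr)

  costF-average : ∀ F → WF F → Satisfiable F → #SL F * costF S s F * frac 1 (length (SL F)) ≡ costF S s F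
  costF-average (cnf [] G) wf h = refl
  costF-average F@(cnf (x ∷ V) G) wf h with satisfiable⁻ wf h
  ... | a , e = trans (solve 3 (λ n k r → n :* k :* r := (r :* n) :* k) refl (#SL F) (costF S s F) r)
      (trans (cong (_* costF S s F) (frac-1 (SL F) (SL-nonempty {F} {a} (wf , e) (here refl)))) (ℚ.*-identityˡ (costF S s F)))
    where
    open +-*-Solver
    r = frac 1 (length (SL F))

theorem6 : (k s : ℕ) (S : ℚ) → 3 ≤ k → AdmissibleS k s S →
    (F : CNF) → WF F → LeK k F → Satisfiable F → SImplicationFree s F →
    sumQ (map (λ l → costF S s (restrict F l)) (SL F)) * frac 1 (length (SL F))
    ≤ℚ costF S s F
    - (frac (nN F) 1 * (S + S)) * frac 1 (length (SL F))
    - frac (nC F) (length (SL F))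
theorem6 k s S _ adm F wf le h free = begin
  A * r
    ≡⟨ solve 4 (λ A B C r → A :* r := (A :+ (B :+ C)) :* r :- B :* r :- C :* r) refl A B C r ⟩
  (A + (B + C)) * r - B * r - C * r
    ≤⟨ ℚ.+-monoˡ-≤ (ℚ.- (C * r)) (ℚ.+-monoˡ-≤ (ℚ.- (B * r))
         (*-monoʳ r (frac-nonNeg 1 (length (SL F))) (total-decrease S s {k} {F} adm wf le h closed))) ⟩
  #SL F * costF S s F * r - B * r - C * r
    ≡⟨ cong₂ (λ p q → p - B * r - q) (costF-average S s F wf h) (sym (frac-scale (nC F) (SL F))) ⟩
  costF S s F - B * r - frac (nC F) (length (SL F)) ∎
  where
  open ℚ.≤-Reasoning
  open +-*-Solver
  r = frac 1 (length (SL F))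
  A = ∑ (SL F) (λ l → costF S s (restrict F l))
  B = frac (nN F) 1 * (S + S)
  C = frac (nC F) 1
  closed : Closed s F
  closed l∈ = All.lookup free (∈-literalsOver⁺ l∈)
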